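{- For every integer $r\geq2$ there exists $x\in\mathbb{A}^{\mathbb{Z}^2}$ with $\mathbb{A}=\{0,1,\ldots,r-1\}$ such that $H_B=\{0\}$ for all $\varnothing\neq B\subsetneq\mathbb{A}$, $x$ admits a transverse recurrence direction, and $$p_x^{*\mathrm{ab}}(k)=(r-1)k+1\quad\text{for all }k\geq1.$$ In particular, $x$ is non-doubly periodic by projection.
   Context: Abelian maximal pattern complexity: for a finite set $S\subset\mathbb{Z}^2$ and $t\in\mathbb{Z}^2$, the $S$-factor of $x$ at $t$ is $x[t+S]=(x(t+s))_{s\in S}\in\mathbb{A}^S$. Two elements of $\mathbb{A}^S$ are Abelian equivalent if each letter of $\mathbb{A}$ occurs the same number of times in both. Let $p_x^{\mathrm{ab}}(S)$ be the number of Abelian equivalence classes of $S$-factors of $x$ (over all $t\in\mathbb{Z}^2$), and $p_x^{*\mathrm{ab}}(k)=\sup\{p_x^{\mathrm{ab}}(S): S\subset\mathbb{Z}^2,\ \#S=k\}$. Periods: for a word $y$ on $\mathbb{Z}^2$, $\operatorname{Per}(y)=\{p\in\mathbb{Z}^2: y(t+p)=y(t)\ \forall t\in\mathbb{Z}^2\}$, a subgroup of $\mathbb{Z}^2$. $y$ is doubly periodic if $\operatorname{Per}(y)$ contains two linearly independent vectors. For $\varnothing\neq B\subsetneq\mathbb{A}$, let $\pi_B(x)=\mathbf{1}_B\circ x\in\{0,1\}^{\mathbb{Z}^2}$ and $H_B=\operatorname{Per}(\pi_B(x))$. $x$ is non-doubly periodic by projection if $\pi_B(x)$ is not doubly periodic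 for every $\varnothing\neq B\subsetneq\mathbb{A}$. Recurrence directions: $\mathbb{P}^1(\mathbb{R})$ is the set of lines through $0$ in $\mathbb{R}^2$; $\operatorname{dir}(q)=\mathbb{R}q$ for $q\neq0$; identifying $\mathbb{P}^1(\mathbb{R})$ with $\mathbb{R}/\pi\mathbb{Z}$ by angle, $d_\pi([\theta],[\phi])=\min_{m\in\mathbb{Z}}|\theta-\phi-m\pi|$. Let $\Sigma_N=[-N,N]^2\cap\mathbb{Z}^2$. $\theta\in\mathbb{P}^1(\mathbb{R})$ is a recurrence direction of $x$ if for all $\varepsilon>0$ and $N\geq1$ there is $q\in\mathbb{Z}^2\setminus\{0\}$ with $x(z+q)=x(z)$ for all $z\in\Sigma_N$ and $d_\pi(\operatorname{dir}(q),\theta)<\varepsilon$. $\mathcal{R}(x)$ is the set of all recurrence directions. If $H_B$ has rank one, $\phi_{H_B}$ is the common direction of its nonzero elements; for $x$ non-doubly periodic by projection, $D_{\mathrm{bad}}(x)=\{\phi_{H_B}:\varnothing\neq B\subsetneq\mathbb{A},\ H_B\neq\{0\}\}$. A recurrence direction is transverse if it lies in $\mathcal{R}(x)\setminus D_{\mathrm{bad}}(x)$. -}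

module Defs where

open import Level using (0ℓ)
open import Data.Bool using (Bool)
open import Data.Nat as ℕ using (ℕ; zero; suc; _!)
open import Data.Nat.Properties using (_!≢0)
open import Data.Integer as ℤ using (ℤ; +_)
open import Data.Rational as ℚ using (ℚ; 0ℚ; 1ℚ)
open import Data.Fin using (Fin; _≟_)
open import Data.Fin.Subset using (Subset; ⊤; Nonempty; _⊂_)
open import Data.Vec as Vec using (Vec)
open import Data.Vec.Relation.Unary.Unique.Propositional using (Unique)
open import Data.Product using (Σ; ∃-syntax; _×_; _,_)
open import Function.Base using (const)
open import Function.Bundles using (Bijection)
open import Relation.Binary.Bundles using (Setoid)
open import Relation.Binary.PropositionalEquality as ≡ using (_≡_; _≢_)
open import Relation.Nullary using (¬_)
open import Relation.Unary using (Pred; _∈_; _∉_)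
open import Algebra.Definitions.RawSemiring ℚ.+-*-rawSemiring using (_^_)

------------------------------------------------------------------------
-- The lattice ℤ² and words on it

ℤ² : Set
ℤ² = ℤ × ℤ

0² : ℤ²
0² = ℤ.0ℤ , ℤ.0ℤ

infixl 6 _⊕_
_⊕_ : ℤ² → ℤ² → ℤ²
(a , b) ⊕ (c , d) = a ℤ.+ c , b ℤ.+ d

infixl 7 _⊙_
_⊙_ : ℤ → ℤ² → ℤ²
m ⊙ (a , b) = m ℤ.* a , m ℤ.* b

Word : Set → Set
Word A = ℤ² → A

------------------------------------------------------------------------
-- Abelian maximal pattern complexity

-- A set of k points of ℤ² is given by a repetition-free enumeration; none of
-- the notions below depend on the order of the enumeration.
FinSet : ℕ → Set
FinSet k = Σ (Vec ℤ² k) Unique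

factor : ∀ {A k} → Word A → FinSet k → ℤ² → Vec A k
factor x (S , _) t = Vec.map (λ s → x (t ⊕ s)) S

AbelianEquivalent : ∀ {r k} → Vec (Fin r) k → Vec (Fin r) k → Set
AbelianEquivalent u v = ∀ a → Vec.count (a ≟_) u ≡ Vec.count (a ≟_) v

-- The S-factors of x up to Abelian equivalence, each S-factor x[t+S] being
-- represented by a position t.
AbelianClasses : ∀ {r k} → Word (Fin r) → FinSet k → Setoid 0ℓ 0ℓ
AbelianClasses x S = record
  { Carrier       = ℤ²
  ; _≈_           = λ t u → AbelianEquivalent (factor x S t) (factor x S u)
  ; isEquivalence = record
    { refl  = λ _ → ≡.refl
    ; sym   = λ p a → ≡.sym (p a)
    ; trans = λ p q a → ≡.trans (p a) (q a)
    }
  }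

AbelianComplexity : ∀ {r k} → Word (Fin r) → FinSet k → Pred ℕ 0ℓ
AbelianComplexity x S n = Bijection (≡.setoid (Fin n)) (AbelianClasses x S)

IsSupremum : Pred ℕ 0ℓ → ℕ → Set
IsSupremum P s = (∀ n → n ∈ P → n ℕ.≤ s)
               × (∀ m → (∀ n → n ∈ P → n ℕ.≤ m) → s ℕ.≤ m)

-- The first component is automatic classically. Constructively it makes sure
-- that every S contributes to the supremum.
AbelianMaximalPatternComplexity : ∀ {r} → Word (Fin r) → ℕ → Pred ℕ 0ℓ
AbelianMaximalPatternComplexity x k s =
    (∀ (S : FinSet k) → ∃[ n ] n ∈ AbelianComplexity x S)
  × IsSupremum (λ n → Σ (FinSet k) λ S → n ∈ AbelianComplexity x S) s

------------------------------------------------------------------------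
-- Periods

Per : ∀ {A} → Word A → Pred ℤ² 0ℓ
Per y p = ∀ t → y (t ⊕ p) ≡ y t

LinearlyIndependent : ℤ² → ℤ² → Set
LinearlyIndependent p q =
  ∀ m n → (m ⊙ p) ⊕ (n ⊙ q) ≡ 0² → m ≡ ℤ.0ℤ × n ≡ ℤ.0ℤ

DoublyPeriodic : ∀ {A} → Word A → Set
DoublyPeriodic y = ∃[ p ] ∃[ q ] p ∈ Per y × q ∈ Per y × LinearlyIndependent p q

Proper : ∀ {r} → Subset r → Set
Proper B = Nonempty B × B ⊂ ⊤

-- A Subset is its own indicator vector, so looking up a letter in B evaluates
-- the indicator function of B (with values in Bool instead of {0,1}).
project : ∀ {r} → Subset r → Word (Fin r) → Word Bool
project B x z = Vec.lookup B (x z)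

H : ∀ {r} → Subset r → Word (Fin r) → Pred ℤ² 0ℓ
H B x = Per (project B x)

NonDoublyPeriodicByProjection : ∀ {r} → Word (Fin r) → Set
NonDoublyPeriodicByProjection x = ∀ B → Proper B → ¬ DoublyPeriodic (project B x)

------------------------------------------------------------------------
-- Real numbers, as Cauchy sequences of rationals

Sequence : Set
Sequence = ℕ → ℚ

record ℝ : Set where
  field
    approx : Sequence
    cauchy : ∀ ε → 0ℚ ℚ.< ε →
             ∃[ M ] ∀ m n → M ℕ.≤ m → M ℕ.≤ n → ℚ.∣ approx m ℚ.- approx n ∣ ℚ.< ε

open ℝ public

-- For convergent sequences, u ≃ v and u ≺ v say that lim u = lim v and
-- lim u < lim v. Stating them for all sequences lets the quantities below be
-- written as sequences converging to the real number they denote.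
infix 4 _≃_ _≺_
_≃_ : Sequence → Sequence → Set
u ≃ v = ∀ ε → 0ℚ ℚ.< ε → ∃[ M ] ∀ n → M ℕ.≤ n → ℚ.∣ u n ℚ.- v n ∣ ℚ.< ε

_≺_ : Sequence → Sequence → Set
u ≺ v = ∃[ δ ] 0ℚ ℚ.< δ × ∃[ M ] ∀ n → M ℕ.≤ n → u n ℚ.+ δ ℚ.≤ v n

fromℤ : ℤ → ℚ
fromℤ m = m ℚ./ 1

∑< : ℕ → (ℕ → ℚ) → ℚ
∑< zero    f = 0ℚ
∑< (suc n) f = ∑< n f ℚ.+ f n

1/_! : ℕ → ℚ
1/ n ! = (+ 1 ℚ./ (n !)) {{n !≢0}}

-- The n-th Taylor partial sum at the n-th approximation of θ; since the series
-- converge uniformly on bounded sets, these tend to sin θ and cos θ.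
sin cos : ℝ → Sequence
sin θ n = ∑< n λ k →
  ((ℚ.- 1ℚ) ^ k) ℚ.* (approx θ n ^ suc (2 ℕ.* k)) ℚ.* 1/ (suc (2 ℕ.* k)) !
cos θ n = ∑< n λ k →
  ((ℚ.- 1ℚ) ^ k) ℚ.* (approx θ n ^ (2 ℕ.* k)) ℚ.* 1/ (2 ℕ.* k) !

-- Leibniz series: π = 4 (1 - 1/3 + 1/5 - ⋯)
π : Sequence
π n = ∑< n λ k → ((ℚ.- 1ℚ) ^ k) ℚ.* (+ 4 ℚ./ suc (2 ℕ.* k))

------------------------------------------------------------------------
-- Directions: a real θ stands for its class in ℝ/πℤ, i.e. for the line
-- ℝ (cos θ , sin θ) of P¹(ℝ)

-- dir(q) = [θ], i.e. q is parallel to (cos θ , sin θ); meant for q ≢ 0²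
HasDirection : ℤ² → ℝ → Set
HasDirection (a , b) θ = (λ n → fromℤ a ℚ.* sin θ n) ≃ (λ n → fromℤ b ℚ.* cos θ n)

-- The minimum over m ∈ ℤ of ∣θ - φ - mπ∣ is less than ε iff one of the values is.
DistLess : ℝ → ℝ → ℝ → Set
DistLess θ φ ε = ∃[ m ]
  (λ n → ℚ.∣ approx θ n ℚ.- approx φ n ℚ.- fromℤ m ℚ.* π n ∣) ≺ approx ε

-- d_π(dir(q) , [θ]) < ε
DirDistLess : ℤ² → ℝ → ℝ → Set
DirDistLess q θ ε = ∃[ φ ] HasDirection q φ × DistLess φ θ ε

Box : ℕ → Pred ℤ² 0ℓ
Box N (a , b) = (ℤ.- (+ N) ℤ.≤ a × a ℤ.≤ + N) × (ℤ.- (+ N) ℤ.≤ b × b ℤ.≤ + N)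

RecurrenceDirection : ∀ {A} → Word A → Pred ℝ 0ℓ
RecurrenceDirection x θ =
  ∀ (ε : ℝ) → const 0ℚ ≺ approx ε → ∀ N → 1 ℕ.≤ N →
  ∃[ q ] q ≢ 0² × (∀ z → z ∈ Box N → x (z ⊕ q) ≡ x z) × DirDistLess q θ ε

-- The set of the φ_{H_B} for proper B with H_B ≠ {0}. It is used for words that
-- are non-doubly periodic by projection, where H_B ≠ {0} means rank one.
BadDirection : ∀ {r} → Word (Fin r) → Pred ℝ 0ℓ
BadDirection x θ = ∃[ B ] Proper B
  × (∃[ p ] p ∈ H B x × p ≢ 0²)
  × (∀ p → p ∈ H B x → p ≢ 0² → HasDirection p θ)

TransverseRecurrenceDirection : ∀ {r} → Word (Fin r) → Pred ℝ 0ℓ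
TransverseRecurrenceDirection x θ = θ ∈ RecurrenceDirection x × θ ∉ BadDirection x

{-# OPTIONS --safe #-}
-- Order ℤ² by the linear form (a , b) ↦ aα - b for an irrational α and let the letter at z
-- count how many of the points z, z + (0,1), …, z + (0,r-2) are positive. This word is monotone in
-- the position, so for each S the S-factors form a chain in which the total of the letters
-- determines the factor; an S-factor changes only when t crosses one of the (r-1)k points
-- -(s + (0,h)), and these are distinct if S lies on a horizontal line. A period of a projection
-- would move the lowest threshold at which the projection changes into a region where it is
-- constant.
--
-- For α = Σ_{j≥1} 1/denⱼ with rapidly growing denⱼ the order is a limit of the orders given by the
-- partial sums numⱼ/denⱼ, hence decidable, and translation by qⱼ = (denⱼ , numⱼ), which is almost
-- in the kernel of the form, does not change the sign of the points of a large box. The angles of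
-- qⱼ converge to an angle θ, which is therefore a recurrence direction; it is transverse because
-- there are no periods.
module Submission where

open import Defs
open import Level using (0ℓ)
open import Data.Bool using (Bool; true; false; T; if_then_else_)
open import Data.Fin as Fin using (Fin; zero; suc; toℕ; fromℕ<; remQuot; combine)
import Data.Fin.Properties as Finₚ
open import Data.Fin.Subset using (Subset)
open import Data.Integer as ℤ using (ℤ; +_; -[1+_]; 0ℤ; 1ℤ; +≤+; -≤-)
import Data.Integer.Properties as ℤₚ
open import Data.Integer.Tactic.RingSolver using (solve-∀)
open import Data.Nat as ℕ using (ℕ; zero; suc)
import Data.Nat.Properties as ℕₚ
open import Data.Nat.Tactic.RingSolver using () renaming (solve-∀ to solve-∀ᴺ)
open import Data.Product using (Σ; ∃-syntax; _×_; _,_; proj₁; proj₂)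
open import Data.Product.Properties using (≡-dec)
open import Data.Rational as ℚ using (ℚ; mkℚ; 0ℚ; 1ℚ; ½)
import Data.Rational.Properties as ℚₚ
open import Data.Rational.Solver using (module +-*-Solver)
open import Data.Rational.Unnormalised as ℚᵘ using (mkℚᵘ)
import Data.Rational.Unnormalised.Properties as ℚᵘₚ
open import Data.Sum using (_⊎_; inj₁; inj₂)
open import Data.Vec as Vec using (Vec; []; _∷_; lookup)
import Data.Vec.Properties as Vecₚ
open import Data.Vec.Relation.Unary.Unique.Propositional.Properties using (tabulate⁺)
open import Function.Base using (_∘_; id)
open import Function.Bundles using (_⇔_; mk⇔; Equivalence; Bijection)
import Function.Properties.Equivalence as ⇔
open import Relation.Binary.Bundles using (Setoid)
open import Relation.Binary.Definitions using (Decidable; tri<; tri≈; tri>)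
open import Relation.Binary.PropositionalEquality
open import Relation.Nullary using (¬_; Dec; yes; no; does; contradiction)
open import Relation.Unary using (_∈_; _≐_; ｛_｝)
open import Algebra.Definitions.RawSemiring ℚ.+-*-rawSemiring using (_^_)
open import Algebra.Properties.CommutativeMonoid.Sum ℕₚ.+-0-commutativeMonoid
  using (sum; sum-cong-≗; ∑-distrib-+; sum-replicate-zero)

-- The positive points

infix 8 ⊖_
⊖_ : ℤ² → ℤ²
⊖ (a , b) = ℤ.- a , ℤ.- b

-- The start value 16 keeps the slopes num j / den j below 2⁻⁴, where arctangents can be computed by
-- a contraction.
den num scale : ℕ → ℕ
den zero    = 16
den (suc j) = scale j ℕ.* den j
num zero    = 0
num (suc j) = suc (scale j ℕ.* num j)
scale j = 2 ℕ.* den j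

form : ℕ → ℤ² → ℤ
form j (a , b) = a ℤ.* + num j ℤ.- b ℤ.* + den j

-- The sign of form j (a , b) is the same for all j > ∣ a ∣.
Positive : ℤ² → Set
Positive z = 0ℤ ℤ.≤ form (suc ℤ.∣ proj₁ z ∣) z

positive? : ∀ z → Dec (Positive z)
positive? z = 0ℤ ℤ.≤? _

-- Consequently `∣ a ∣` itself can serve as a stage at which the sign of a point with first
-- coordinate `a` is settled.
j<den : ∀ j → j ℕ.< den j
j<den zero    = ℕ.s≤s ℕ.z≤n
j<den (suc j) = begin-strict
  suc j  ≤⟨ j<den j ⟩
  den j
    <⟨ ℕₚ.m<m+n (den j) (ℕₚ.≤-<-trans ℕ.z≤n (ℕₚ.<-≤-trans (j<den j) (ℕₚ.m≤m+n (den j) 0))) ⟩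
  scale j            ≡⟨ ℕₚ.*-identityʳ (scale j) ⟨
  scale j ℕ.* 1      ≤⟨ ℕₚ.*-monoʳ-≤ (scale j) (ℕₚ.≤-<-trans ℕ.z≤n (j<den j)) ⟩
  scale j ℕ.* den j  ∎
  where open ℕₚ.≤-Reasoning

den≤scale : ∀ j → den j ℕ.≤ scale j
den≤scale j = ℕₚ.m≤m+n (den j) _

den-nonZero : ∀ j → ℕ.NonZero (den j)
den-nonZero j = ℕ.>-nonZero (ℕₚ.≤-<-trans ℕ.z≤n (j<den j))

scale≤den : ∀ j → scale j ℕ.≤ den (suc j)
scale≤den j = ℕₚ.m≤m*n (scale j) (den j) {{den-nonZero j}}

den-mono : ∀ {i j} → i ℕ.≤ j → den i ℕ.≤ den j
den-mono {i} i≤j with ℕₚ.m≤n⇒∃[o]m+o≡n i≤j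
... | k , refl = go k
  where
  go : ∀ k → den i ℕ.≤ den (i ℕ.+ k)
  go zero    = ℕₚ.≤-reflexive (cong den (sym (ℕₚ.+-identityʳ i)))
  go (suc k) = ℕₚ.≤-trans (go k) (ℕₚ.≤-trans (ℕₚ.≤-trans (den≤scale (i ℕ.+ k)) (scale≤den (i ℕ.+ k)))
    (ℕₚ.≤-reflexive (cong den (sym (ℕₚ.+-suc i k)))))

scale-mono : ∀ {i j} → i ℕ.≤ j → scale i ℕ.≤ scale j
scale-mono = ℕₚ.*-monoʳ-≤ 2 ∘ den-mono

-- The slope grows by `1 / den (suc j)`, which scales the form by `scale j` and perturbs it by `a`.
-- As long as `∣ a ∣ < scale j`, the perturbation cannot undo a nonzero multiple of `scale j`; all
-- sign arguments below use this.
form-suc : ∀ j a b → form (suc j) (a , b) ≡ + scale j ℤ.* form j (a , b) ℤ.+ a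
form-suc j a b = begin
  a ℤ.* + suc (scale j ℕ.* num j) ℤ.- b ℤ.* + (scale j ℕ.* den j)
    ≡⟨ cong₂ (λ u v → a ℤ.* (1ℤ ℤ.+ u) ℤ.- b ℤ.* v) (ℤₚ.pos-* (scale j) (num j))
      (ℤₚ.pos-* (scale j) (den j)) ⟩
  a ℤ.* (1ℤ ℤ.+ + scale j ℤ.* + num j) ℤ.- b ℤ.* (+ scale j ℤ.* + den j)
    ≡⟨ lemma a b (+ den j) (+ num j) (+ scale j) ⟩
  + scale j ℤ.* (a ℤ.* + num j ℤ.- b ℤ.* + den j) ℤ.+ a ∎
  where
  open ≡-Reasoning
  lemma : ∀ a b A B C → a ℤ.* (1ℤ ℤ.+ C ℤ.* B) ℤ.- b ℤ.* (C ℤ.* A)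
                      ≡ C ℤ.* (a ℤ.* B ℤ.- b ℤ.* A) ℤ.+ a
  lemma = solve-∀

form-⊕ : ∀ j z w → form j (z ⊕ w) ≡ form j z ℤ.+ form j w
form-⊕ j (a , b) (c , d) = lemma a b c d (+ den j) (+ num j)
  where
  lemma : ∀ a b c d A B → (a ℤ.+ c) ℤ.* B ℤ.- (b ℤ.+ d) ℤ.* A
                        ≡ (a ℤ.* B ℤ.- b ℤ.* A) ℤ.+ (c ℤ.* B ℤ.- d ℤ.* A)
  lemma = solve-∀

form-⊖ : ∀ j z → form j (⊖ z) ≡ ℤ.- form j z
form-⊖ j (a , b) = lemma a b (+ den j) (+ num j)
  where
  lemma : ∀ a b A B → ℤ.- a ℤ.* B ℤ.- ℤ.- b ℤ.* A ≡ ℤ.- (a ℤ.* B ℤ.- b ℤ.* A)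
  lemma = solve-∀

∣a∣<n⇒a<n : ∀ {a n} → ℤ.∣ a ∣ ℕ.< n → a ℤ.< + n
∣a∣<n⇒a<n {+ _}      a<n = ℤ.+<+ a<n
∣a∣<n⇒a<n { -[1+ _ ]} _   = ℤ.-<+

-- Integrality is decisive: `l` is at least 1, so `c * l` is at least `c`, which outweighs `a`.
c*l+a>0 : ∀ {a l c} → ℤ.∣ a ∣ ℕ.< c → 0ℤ ℤ.< l → 0ℤ ℤ.< + c ℤ.* l ℤ.+ a
c*l+a>0 {a} {l} {c} a<c l>0 = begin-strict
  0ℤ  ≡⟨ sym (ℤₚ.+-inverseˡ a) ⟩
  ℤ.- a ℤ.+ a
    <⟨ ℤₚ.+-monoˡ-< a (∣a∣<n⇒a<n {ℤ.- a} (subst (ℕ._< c) (sym (ℤₚ.∣-i∣≡∣i∣ a)) a<c)) ⟩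
  + c ℤ.+ a         ≡⟨ cong (ℤ._+ a) (ℤₚ.*-identityʳ (+ c)) ⟨
  + c ℤ.* 1ℤ ℤ.+ a  ≤⟨ ℤₚ.+-monoˡ-≤ a (ℤₚ.*-monoˡ-≤-nonNeg (+ c) (ℤₚ.i<j⇒suc[i]≤j l>0)) ⟩
  + c ℤ.* l ℤ.+ a   ∎
  where open ℤₚ.≤-Reasoning

c*l+a<0 : ∀ {a l c} → ℤ.∣ a ∣ ℕ.< c → l ℤ.< 0ℤ → + c ℤ.* l ℤ.+ a ℤ.< 0ℤ
c*l+a<0 {a} {l} {c} a<c l<0 = ℤₚ.neg-cancel-< (subst (0ℤ ℤ.<_) (lemma (+ c) l a)
  (c*l+a>0 (subst (ℕ._< c) (sym (ℤₚ.∣-i∣≡∣i∣ a)) a<c) (ℤₚ.neg-mono-< l<0)))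
  where
  lemma : ∀ c l a → c ℤ.* ℤ.- l ℤ.+ ℤ.- a ≡ ℤ.- (c ℤ.* l ℤ.+ a)
  lemma = solve-∀

-- Stands in for the irrationality of α. A nonzero sign of `form j` would persist to the next stage,
-- so `form j` vanishes too; the recursion then leaves `a ≡ 0`, and `b` times `den j` is zero.
form≡0⇒≡0² : ∀ j z → ℤ.∣ proj₁ z ∣ ℕ.< scale j → form (suc j) z ≡ 0ℤ → z ≡ 0²
form≡0⇒≡0² j (a , b) a<scale eq with trans (sym (form-suc j a b)) eq
... | eq′ with ℤₚ.<-cmp (form j (a , b)) 0ℤ
... | tri< l<0 _ _ = contradiction eq′ (ℤₚ.<⇒≢ (c*l+a<0 a<scale l<0))
... | tri> _ _ l>0 = contradiction (sym eq′) (ℤₚ.<⇒≢ (c*l+a>0 a<scale l>0))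
... | tri≈ _ l≡0 _ = cong₂ _,_ a≡0 b≡0
  where
  a≡0 : a ≡ 0ℤ
  a≡0 = begin
    a                                   ≡⟨ ℤₚ.+-identityˡ a ⟨
    0ℤ ℤ.+ a                            ≡⟨ cong (ℤ._+ a) (ℤₚ.*-zeroʳ (+ scale j)) ⟨
    + scale j ℤ.* 0ℤ ℤ.+ a              ≡⟨ cong (λ l → + scale j ℤ.* l ℤ.+ a) l≡0 ⟨
    + scale j ℤ.* form j (a , b) ℤ.+ a  ≡⟨ eq′ ⟩
    0ℤ                                  ∎
    where open ≡-Reasoning
  b*den≡0 : b ℤ.* + den j ≡ 0ℤ
  b*den≡0 = ℤₚ.neg-injective (begin
    ℤ.- (b ℤ.* + den j)               ≡⟨ ℤₚ.+-identityˡ _ ⟨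
    0ℤ ℤ.* + num j ℤ.- b ℤ.* + den j  ≡⟨ cong (λ a → a ℤ.* + num j ℤ.- b ℤ.* + den j) a≡0 ⟨
    form j (a , b)                    ≡⟨ l≡0 ⟩
    0ℤ                                ∎)
    where open ≡-Reasoning
  b≡0 : b ≡ 0ℤ
  b≡0 = ℤₚ.*-cancelʳ-≡ b 0ℤ (+ den j) {{den-nonZero j}} b*den≡0

-- The comparison starts at stage `suc j` because `form j` may vanish at a nonzero point such as
-- `kernelPoint j`, where only the next stage decides. From `suc j` on, a zero value means the
-- origin.
stable-suc : ∀ j z → ℤ.∣ proj₁ z ∣ ℕ.< scale j →
             0ℤ ℤ.≤ form (suc j) z ⇔ 0ℤ ℤ.≤ form (suc (suc j)) z
stable-suc j z@(a , b) a<scale with ℤₚ.<-cmp (form (suc j) z) 0ℤ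
... | tri< l<0 _ _ = mk⇔ (λ l≥0 → contradiction l<0 (ℤₚ.≤⇒≯ l≥0))
                         (λ l≥0 → contradiction (subst (ℤ._< 0ℤ) (sym (form-suc (suc j) a b))
                           (c*l+a<0 a<scale′ l<0)) (ℤₚ.≤⇒≯ l≥0))
  where a<scale′ = ℕₚ.<-≤-trans a<scale (scale-mono (ℕₚ.n≤1+n j))
... | tri> _ _ l>0 = mk⇔ (λ _ → ℤₚ.<⇒≤
  (subst (0ℤ ℤ.<_) (sym (form-suc (suc j) a b)) (c*l+a>0 a<scale′ l>0))) (λ _ → ℤₚ.<⇒≤ l>0)
  where a<scale′ = ℕₚ.<-≤-trans a<scale (scale-mono (ℕₚ.n≤1+n j))
... | tri≈ _ l≡0 _ with refl ← form≡0⇒≡0² j z a<scale l≡0 = mk⇔ (λ _ → ℤₚ.≤-refl) (λ _ → ℤₚ.≤-refl)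

stable : ∀ j z → ℤ.∣ proj₁ z ∣ ℕ.< scale j → ∀ k →
         0ℤ ℤ.≤ form (suc j) z ⇔ 0ℤ ℤ.≤ form (suc (k ℕ.+ j)) z
stable j z a<scale zero    = ⇔.refl
stable j z a<scale (suc k) = ⇔.trans (stable j z a<scale k)
  (stable-suc (k ℕ.+ j) z (ℕₚ.<-≤-trans a<scale (scale-mono (ℕₚ.m≤n+m j k))))

∣a∣<scale : ∀ a → ℤ.∣ a ∣ ℕ.< scale ℤ.∣ a ∣
∣a∣<scale a = ℕₚ.<-≤-trans (j<den ℤ.∣ a ∣) (den≤scale ℤ.∣ a ∣)

-- Frees `Positive` from the stage built into it, so that several points can be tested at a common
-- stage.
Positive⇔ : ∀ j z → ℤ.∣ proj₁ z ∣ ℕ.< scale j → Positive z ⇔ 0ℤ ℤ.≤ form (suc j) z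
Positive⇔ j z@(a , _) a<scale = ⇔.trans (stable ℤ.∣ a ∣ z (∣a∣<scale a) j)
  (subst (λ i → 0ℤ ℤ.≤ form (suc i) z ⇔ 0ℤ ℤ.≤ form (suc j) z) (ℕₚ.+-comm ℤ.∣ a ∣ j)
    (⇔.sym (stable j z a<scale ℤ.∣ a ∣)))

-- The positive points form the cone of a total order

Positive-⊕ : ∀ z w → Positive z → Positive w → Positive (z ⊕ w)
Positive-⊕ z@(a , _) w@(c , _) z≥0 w≥0 =
  from (Positive⇔ j (z ⊕ w) (lt (a ℤ.+ c) (ℤₚ.∣i+j∣≤∣i∣+∣j∣ a c)))
    (subst (0ℤ ℤ.≤_) (sym (form-⊕ (suc j) z w))
      (ℤₚ.+-mono-≤ (to (Positive⇔ j z (lt a (ℕₚ.m≤m+n _ _))) z≥0)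
                   (to (Positive⇔ j w (lt c (ℕₚ.m≤n+m _ _))) w≥0)))
  where
  open Equivalence
  -- A stage late enough for `z`, `w` and their sum, where additivity of `form` applies.
  j = ℤ.∣ a ∣ ℕ.+ ℤ.∣ c ∣
  lt : ∀ e → ℤ.∣ e ∣ ℕ.≤ j → ℤ.∣ e ∣ ℕ.< scale j
  lt e e≤j = ℕₚ.<-≤-trans (∣a∣<scale e) (scale-mono e≤j)

form-⊖-stage : ∀ z → form (suc ℤ.∣ proj₁ (⊖ z) ∣) (⊖ z) ≡ ℤ.- form (suc ℤ.∣ proj₁ z ∣) z
form-⊖-stage z@(a , _) = trans (cong (λ j → form (suc j) (⊖ z)) (ℤₚ.∣-i∣≡∣i∣ a))
  (form-⊖ (suc ℤ.∣ a ∣) z)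

Positive-total : ∀ z → Positive z ⊎ Positive (⊖ z)
Positive-total z with ℤₚ.≤-total 0ℤ (form (suc ℤ.∣ proj₁ z ∣) z)
... | inj₁ l≥0 = inj₁ l≥0
... | inj₂ l≤0 = inj₂ (subst (0ℤ ℤ.≤_) (sym (form-⊖-stage z)) (ℤₚ.neg-mono-≤ l≤0))

Positive-antisym : ∀ z → Positive z → Positive (⊖ z) → z ≡ 0²
Positive-antisym z z≥0 -z≥0 = form≡0⇒≡0² ℤ.∣ proj₁ z ∣ z (∣a∣<scale (proj₁ z))
  (ℤₚ.≤-antisym (ℤₚ.neg-cancel-≤ (subst (0ℤ ℤ.≤_) (form-⊖-stage z) -z≥0)) z≥0)

kernelPoint : ℕ → ℤ²
kernelPoint j = + den j , + num j

form-kernelPoint : ∀ j → form j (kernelPoint j) ≡ 0ℤ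
form-kernelPoint j = trans (cong (λ l → l ℤ.- + num j ℤ.* + den j) (ℤₚ.*-comm (+ den j) (+ num j)))
  (ℤₚ.+-inverseʳ (+ num j ℤ.* + den j))

-- With `i = suc j`, translation by `kernelPoint i` leaves `form i` unchanged and adds only `den i`
-- to the form at stage `suc i`. The factor 2 in `scale` gives `∣ a ∣ + den i < scale i`, so a
-- nonzero `form i z` determines both signs.
Positive-recurrent : ∀ j z → ℤ.∣ proj₁ z ∣ ℕ.< den j → Positive (z ⊕ kernelPoint (suc j)) ⇔ Positive z
Positive-recurrent j z@(a , b) a<den =
  ⇔.trans (Positive⇔ i (z ⊕ kernelPoint i) a+den<scale) (⇔.trans core (⇔.sym (Positive⇔ i z a<scale)))
  where
  i = suc j
  a<scale : ℤ.∣ a ∣ ℕ.< scale i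
  a<scale = ℕₚ.<-≤-trans a<den (ℕₚ.≤-trans (den-mono (ℕₚ.n≤1+n j)) (den≤scale i))
  a+den<scale : ℤ.∣ a ℤ.+ + den i ∣ ℕ.< scale i
  a+den<scale = ℕₚ.≤-<-trans (ℤₚ.∣i+j∣≤∣i∣+∣j∣ a (+ den i))
    (ℕₚ.<-≤-trans (ℕₚ.+-monoˡ-< (den i) (ℕₚ.<-≤-trans a<den (den-mono (ℕₚ.n≤1+n j))))
     (ℕₚ.≤-reflexive (cong (den i ℕ.+_) (sym (ℕₚ.+-identityʳ (den i))))))
  eq : form (suc i) (z ⊕ kernelPoint i) ≡ + scale i ℤ.* form i z ℤ.+ (a ℤ.+ + den i)
  eq = trans (form-suc i (a ℤ.+ + den i) (b ℤ.+ + num i))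
    (cong (λ l → + scale i ℤ.* l ℤ.+ (a ℤ.+ + den i))
         (trans (form-⊕ i z (kernelPoint i)) (trans (cong (λ l → form i z ℤ.+ l) (form-kernelPoint i))
           (ℤₚ.+-identityʳ (form i z)))))
  core : 0ℤ ℤ.≤ form (suc i) (z ⊕ kernelPoint i) ⇔ 0ℤ ℤ.≤ form (suc i) z
  core with ℤₚ.<-cmp (form i z) 0ℤ
  ... | tri< l<0 _ _ = mk⇔
    (λ l≥0 → contradiction (subst (ℤ._< 0ℤ) (sym eq) (c*l+a<0 a+den<scale l<0)) (ℤₚ.≤⇒≯ l≥0))
    (λ l≥0 → contradiction (subst (ℤ._< 0ℤ) (sym (form-suc i a b)) (c*l+a<0 a<scale l<0)) (ℤₚ.≤⇒≯ l≥0))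
  ... | tri> _ _ l>0 = mk⇔
    (λ _ → ℤₚ.<⇒≤ (subst (0ℤ ℤ.<_) (sym (form-suc i a b)) (c*l+a>0 a<scale l>0)))
    (λ _ → ℤₚ.<⇒≤ (subst (0ℤ ℤ.<_) (sym eq) (c*l+a>0 a+den<scale l>0)))
  -- Only the origin is left. It counts as positive, and so does its translate, whose form is
  -- `den i`.
  ... | tri≈ _ l≡0 _ with refl ← form≡0⇒≡0² j z (ℕₚ.<-≤-trans a<den (den≤scale j)) l≡0 =
    mk⇔ (λ _ → ℤₚ.≤-refl)
        (λ _ → subst (0ℤ ℤ.≤_) (sym eq) (subst (λ x → 0ℤ ℤ.≤ x ℤ.+ (0ℤ ℤ.+ + den i))
          (sym (ℤₚ.*-zeroʳ (+ scale i))) (+≤+ ℕ.z≤n)))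

-- Finite sums

sum-mono : ∀ {n} {f g : Fin n → ℕ} → (∀ i → f i ℕ.≤ g i) → sum f ℕ.≤ sum g
sum-mono {zero}  f≤g = ℕ.z≤n
sum-mono {suc n} f≤g = ℕₚ.+-mono-≤ (f≤g zero) (sum-mono (f≤g ∘ suc))

-- Equal totals leave no slack in termwise inequalities. Used twice: from the total of a factor to
-- its letters, and from a letter to the points that it counts.
sum-≤-≡⇒≗ : ∀ {n} {f g : Fin n → ℕ} → (∀ i → f i ℕ.≤ g i) → sum f ≡ sum g → f ≗ g
sum-≤-≡⇒≗ {suc n} {f} {g} f≤g eq = λ { zero → f0≡g0 ; (suc i) → sum-≤-≡⇒≗ (f≤g ∘ suc) tails i }
  where
  tail≤ : sum (f ∘ suc) ℕ.≤ sum (g ∘ suc)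
  tail≤ = sum-mono (f≤g ∘ suc)
  f0≡g0 : f zero ≡ g zero
  f0≡g0 = ℕₚ.≤-antisym (f≤g zero) (ℕₚ.+-cancelʳ-≤ (sum (f ∘ suc)) (g zero) (f zero)
    (ℕₚ.≤-trans (ℕₚ.+-monoʳ-≤ (g zero) tail≤) (ℕₚ.≤-reflexive (sym eq))))
  tails : sum (f ∘ suc) ≡ sum (g ∘ suc)
  tails = ℕₚ.+-cancelˡ-≡ (f zero) _ _ (trans eq (cong (ℕ._+ sum (g ∘ suc)) (sym f0≡g0)))

indicator : Bool → ℕ
indicator b = if b then 1 else 0

indicator≤1 : ∀ b → indicator b ℕ.≤ 1
indicator≤1 true  = ℕₚ.≤-refl
indicator≤1 false = ℕ.z≤n

sum≤ : ∀ {n} {f : Fin n → ℕ} → (∀ i → f i ℕ.≤ 1) → sum f ℕ.≤ n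
sum≤ {zero}  f≤1 = ℕ.z≤n
sum≤ {suc n} f≤1 = ℕₚ.+-mono-≤ (f≤1 zero) (sum≤ (f≤1 ∘ suc))

sum-≤ᵇ : ∀ {m n} → n ℕ.< m → sum {m} (λ h → indicator (toℕ h ℕ.≤ᵇ n)) ≡ suc n
sum-≤ᵇ {suc m} {zero}  _         = cong suc (sum-replicate-zero m)
sum-≤ᵇ {suc m} {suc n} (ℕ.s≤s p) = cong suc
  (trans (sum-cong-≗ {m} (λ h → cong indicator (suc-≤ᵇ (toℕ h) n))) (sum-≤ᵇ {m} p))
  where
  suc-≤ᵇ : ∀ k n → (suc k ℕ.≤ᵇ suc n) ≡ (k ℕ.≤ᵇ n)
  suc-≤ᵇ zero    n = refl
  suc-≤ᵇ (suc k) n = refl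

sum-indicator : ∀ {n} (f : Fin n → ℕ) y → sum (λ a → f a ℕ.* indicator (does (a Fin.≟ y))) ≡ f y
sum-indicator {suc n} f zero = begin
  f zero ℕ.* 1 ℕ.+ sum (λ a → f (suc a) ℕ.* 0)
    ≡⟨ cong₂ ℕ._+_ (ℕₚ.*-identityʳ (f zero)) (sum-cong-≗ (λ a → ℕₚ.*-zeroʳ (f (suc a)))) ⟩
  f zero ℕ.+ sum {n} (λ _ → 0)  ≡⟨ cong (λ s → f zero ℕ.+ s) (sum-replicate-zero n) ⟩
  f zero ℕ.+ 0                  ≡⟨ ℕₚ.+-identityʳ (f zero) ⟩
  f zero                        ∎
  where open ≡-Reasoning
sum-indicator {suc n} f (suc y) = cong₂ ℕ._+_ (ℕₚ.*-zeroʳ (f zero)) (sum-indicator (f ∘ suc) y)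

-- Abelian equivalence

letterSum : ∀ {r k} → Vec (Fin r) k → ℕ
letterSum u = sum (λ i → toℕ (lookup u i))

-- Grouping positions by their letter shows that the total depends only on the letter counts, hence
-- is an Abelian invariant.
letterSum≡ : ∀ {r k} (u : Vec (Fin r) k) →
             letterSum u ≡ sum (λ a → toℕ a ℕ.* Vec.count (a Fin.≟_) u)
letterSum≡ {r} []      = sym (trans (sum-cong-≗ (λ a → ℕₚ.*-zeroʳ (toℕ {r} a))) (sum-replicate-zero r))
letterSum≡ {r} (y ∷ u) = begin
  toℕ y ℕ.+ letterSum u
    ≡⟨ cong₂ ℕ._+_ (sym (sum-indicator toℕ y)) (letterSum≡ u) ⟩
  sum (λ a → toℕ a ℕ.* δ a) ℕ.+ sum (λ a → toℕ a ℕ.* c a)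
    ≡⟨ ∑-distrib-+ (λ a → toℕ a ℕ.* δ a) (λ a → toℕ a ℕ.* c a) ⟨
  sum (λ a → toℕ a ℕ.* δ a ℕ.+ toℕ a ℕ.* c a)
    ≡⟨ sum-cong-≗ (λ a → trans (sym (ℕₚ.*-distribˡ-+ (toℕ a) (δ a) (c a)))
      (cong (λ n → toℕ a ℕ.* n) (count-∷ (does (a Fin.≟ y)) (c a)))) ⟩
  sum (λ a → toℕ a ℕ.* Vec.count (a Fin.≟_) (y ∷ u)) ∎
  where
  open ≡-Reasoning
  δ c : Fin r → ℕ
  δ a = indicator (does (a Fin.≟ y))
  c a = Vec.count (a Fin.≟_) u
  count-∷ : ∀ b n → indicator b ℕ.+ n ≡ (if b then suc else id) n
  count-∷ true  n = refl
  count-∷ false n = refl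

AbelianEquivalent⇒letterSum≡ : ∀ {r k} {u v : Vec (Fin r) k} → AbelianEquivalent u v →
  letterSum u ≡ letterSum v
AbelianEquivalent⇒letterSum≡ {u = u} {v} u≈v =
  trans (letterSum≡ u) (trans (sum-cong-≗ (λ a → cong (λ n → toℕ a ℕ.* n) (u≈v a)))
    (sym (letterSum≡ v)))

abelianEquivalent? : ∀ {r k} (u v : Vec (Fin r) k) → Dec (AbelianEquivalent u v)
abelianEquivalent? u v = Finₚ.all? (λ a → _ ℕ.≟ _)

-- Counting the classes of a setoid

module _ (X : Setoid 0ℓ 0ℓ) where
  open Setoid X using (Carrier; _≈_) renaming (refl to ≈-refl; sym to ≈-sym; trans to ≈-trans)

  -- The list `f` is thinned from the end: an entry is kept only if it is inequivalent to every
  -- entry kept so far. Decidability of the equivalence makes the choice.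
  covered⇒finite : (∀ x y → Dec (x ≈ y)) → ∀ {N} (f : Fin N → Carrier) → (∀ x → ∃[ i ] x ≈ f i) →
                   ∃[ n ] Bijection (setoid (Fin n)) X
  covered⇒finite _≈?_ f cover with distinct f
    where
    distinct : ∀ {N} (f : Fin N → Carrier) → ∃[ n ] Σ (Fin n → Carrier) λ g →
               (∀ {i j} → g i ≈ g j → i ≡ j) × (∀ i → ∃[ j ] f i ≈ g j)
    distinct {zero}  f = 0 , (λ ()) , (λ {}) , λ ()
    distinct {suc N} f with distinct (f ∘ suc)
    ... | n , g , inj , cov with Finₚ.any? (λ j → f zero ≈? g j)
    ... | yes ∃j = n , g , inj , λ { zero → ∃j ; (suc i) → cov i }
    ... | no ∄j  = suc n , g′ , inj′ , λ { zero → zero , ≈-refl ; (suc i) →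
      suc (proj₁ (cov i)) , proj₂ (cov i) }
      where
      g′ : Fin (suc n) → Carrier
      g′ zero    = f zero
      g′ (suc j) = g j
      inj′ : ∀ {i j} → g′ i ≈ g′ j → i ≡ j
      inj′ {zero}  {zero}  eq = refl
      inj′ {zero}  {suc j} eq = contradiction (j , eq) ∄j
      inj′ {suc i} {zero}  eq = contradiction (i , ≈-sym eq) ∄j
      inj′ {suc i} {suc j} eq = cong suc (inj eq)
  ... | n , g , inj , cov = n , record
    { to        = g
    ; cong      = λ { refl → ≈-refl }
    ; bijective = inj , λ x → let i , x≈fi = cover x ; j , fi≈gj = cov i in
                    j , λ { refl → ≈-sym (≈-trans x≈fi fi≈gj) }
    }

  -- Pigeonhole: sending each class to the index of a point of `f` equivalent to it is injective.
  covered⇒≤ : ∀ {n N} → Bijection (setoid (Fin n)) X → (f : Fin N → Carrier) → (∀ x → ∃[ i ] x ≈ f i) →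
    n ℕ.≤ N
  covered⇒≤ bij f cover = Finₚ.injective⇒≤ {f = index} λ {i} {j} eq →
    injective (≈-trans (proj₂ (cover (to i)))
      (subst (λ k → f k ≈ to j) (sym eq) (≈-sym (proj₂ (cover (to j))))))
    where
    open Bijection bij
    index = proj₁ ∘ cover ∘ to

  inequivalent⇒≤ : ∀ {n N} → Bijection (setoid (Fin n)) X → (f : Fin N → Carrier) →
    (∀ {i j} → f i ≈ f j → i ≡ j) → N ℕ.≤ n
  inequivalent⇒≤ bij f inj = Finₚ.injective⇒≤ {f = index} λ {i} {j} eq →
    inj (≈-trans (≈-sym (proj₂ (surjective (f i)) refl))
                 (subst (λ k → to k ≈ f j) (sym eq) (proj₂ (surjective (f j)) refl)))
    where
    open Bijection bij
    index = proj₁ ∘ surjective ∘ f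

-- The order on ℤ²

infix 4 _⊑_
_⊑_ : ℤ² → ℤ² → Set
t ⊑ u = Positive (u ⊕ ⊖ t)

_⊑?_ : Decidable _⊑_
t ⊑? u = positive? (u ⊕ ⊖ t)

⊕-identityʳ : ∀ z → z ⊕ 0² ≡ z
⊕-identityʳ (a , b) = cong₂ _,_ (ℤₚ.+-identityʳ a) (ℤₚ.+-identityʳ b)

⊕-identityˡ : ∀ z → 0² ⊕ z ≡ z
⊕-identityˡ (a , b) = cong₂ _,_ (ℤₚ.+-identityˡ a) (ℤₚ.+-identityˡ b)

⊕-inverseʳ : ∀ z → z ⊕ ⊖ z ≡ 0²
⊕-inverseʳ (a , b) = cong₂ _,_ (ℤₚ.+-inverseʳ a) (ℤₚ.+-inverseʳ b)

⊕-swap : ∀ z q w → (z ⊕ q) ⊕ w ≡ (z ⊕ w) ⊕ q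
⊕-swap (a , b) (c , d) (e , f) = cong₂ _,_ (lemma a c e) (lemma b d f)
  where
  lemma : ∀ a c e → (a ℤ.+ c) ℤ.+ e ≡ (a ℤ.+ e) ℤ.+ c
  lemma = solve-∀

⊕-cancel : ∀ z q → (z ⊕ ⊖ q) ⊕ q ≡ z
⊕-cancel (a , b) (c , d) = cong₂ _,_ (lemma a c) (lemma b d)
  where
  lemma : ∀ a c → (a ℤ.+ ℤ.- c) ℤ.+ c ≡ a
  lemma = solve-∀

⊕-shift : ∀ t u s → (t ⊕ s) ⊕ (u ⊕ ⊖ t) ≡ u ⊕ s
⊕-shift (a , b) (c , d) (e , f) = cong₂ _,_ (lemma a c e) (lemma b d f)
  where
  lemma : ∀ a c e → (a ℤ.+ e) ℤ.+ (c ℤ.+ ℤ.- a) ≡ c ℤ.+ e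
  lemma = solve-∀

⊕-⊖-⊖ : ∀ t s w → t ⊕ ⊖ (⊖ (s ⊕ w)) ≡ (t ⊕ s) ⊕ w
⊕-⊖-⊖ (a , b) (c , d) (e , f) = cong₂ _,_ (lemma a c e) (lemma b d f)
  where
  lemma : ∀ a c e → a ℤ.+ ℤ.- ℤ.- (c ℤ.+ e) ≡ (a ℤ.+ c) ℤ.+ e
  lemma = solve-∀

⊖-⊕-⊖ : ∀ t u → ⊖ (u ⊕ ⊖ t) ≡ t ⊕ ⊖ u
⊖-⊕-⊖ (a , b) (c , d) = cong₂ _,_ (lemma a c) (lemma b d)
  where
  lemma : ∀ a c → ℤ.- (c ℤ.+ ℤ.- a) ≡ a ℤ.+ ℤ.- c
  lemma = solve-∀

⊕-⊖-shift : ∀ t w → t ⊕ ⊖ (t ⊕ w) ≡ ⊖ w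
⊕-⊖-shift (a , b) (c , d) = cong₂ _,_ (lemma a c) (lemma b d)
  where
  lemma : ∀ a c → a ℤ.+ ℤ.- (a ℤ.+ c) ≡ ℤ.- c
  lemma = solve-∀

⊖-involutive : ∀ z → ⊖ ⊖ z ≡ z
⊖-involutive (a , b) = cong₂ _,_ (ℤₚ.neg-involutive a) (ℤₚ.neg-involutive b)

Positive-0² : Positive 0²
Positive-0² = ℤₚ.≤-refl

⊑-refl : ∀ t → t ⊑ t
⊑-refl t = subst Positive (sym (⊕-inverseʳ t)) Positive-0²

-- Adding the positive difference `u ⊕ ⊖ t` turns `t ⊕ s` into `u ⊕ s`. The word is monotone for
-- this reason.
⊑⇒Positive : ∀ t u → t ⊑ u → ∀ s → Positive (t ⊕ s) → Positive (u ⊕ s)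
⊑⇒Positive t u t⊑u s p = subst Positive (⊕-shift t u s) (Positive-⊕ (t ⊕ s) (u ⊕ ⊖ t) p t⊑u)

⊑-trans : ∀ t u v → t ⊑ u → u ⊑ v → t ⊑ v
⊑-trans t u v t⊑u u⊑v = ⊑⇒Positive u v u⊑v (⊖ t) t⊑u

⊑-total : ∀ t u → t ⊑ u ⊎ u ⊑ t
⊑-total t u with Positive-total (u ⊕ ⊖ t)
... | inj₁ p = inj₁ p
... | inj₂ p = inj₂ (subst Positive (⊖-⊕-⊖ t u) p)

⊑-antisym : ∀ t u → t ⊑ u → u ⊑ t → t ≡ u
⊑-antisym t u t⊑u u⊑t = trans (sym (⊕-identityˡ t)) (trans (cong (_⊕ t) (sym eq)) (⊕-cancel u t))
  where
  eq : u ⊕ ⊖ t ≡ 0²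
  eq = Positive-antisym (u ⊕ ⊖ t) t⊑u (subst Positive (sym (⊖-⊕-⊖ t u)) u⊑t)

⊑-⊕ : ∀ t u s → t ⊑ u → t ⊕ s ⊑ u ⊕ s
⊑-⊕ t u s = subst Positive (lemma t u s)
  where
  lemma : ∀ t u s → u ⊕ ⊖ t ≡ (u ⊕ s) ⊕ ⊖ (t ⊕ s)
  lemma (a , b) (c , d) (e , f) = cong₂ _,_ (lemma′ a c e) (lemma′ b d f)
    where
    lemma′ : ∀ a c e → c ℤ.+ ℤ.- a ≡ (c ℤ.+ e) ℤ.+ ℤ.- (a ℤ.+ e)
    lemma′ = solve-∀

-- Gaps cut out by finitely many points

lowerPoint : ∀ {n} (v : Fin n → ℤ²) → ∃[ t ] ∀ j → ¬ v j ⊑ t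
lowerPoint {zero}  v = 0² , λ ()
lowerPoint {suc n} v with lowerPoint (v ∘ suc)
... | t , t-lower with v zero ⊑? t
... | no  v0⋢t = t , λ { zero → v0⋢t ; (suc j) → t-lower j }
-- The point `(0 , 1)` is negative, so this lies strictly below `v zero`, and hence below `t`, which
-- is below all the others.
... | yes v0⊑t = v zero ⊕ (0ℤ , 1ℤ) , λ
  { zero    v0⊑ → contradiction (subst Positive
    (trans (⊕-swap (v zero) (0ℤ , 1ℤ) (⊖ v zero)) (cong (_⊕ (0ℤ , 1ℤ)) (⊕-inverseʳ (v zero)))) v0⊑) λ ()
  ; (suc j) vj⊑ → t-lower j (⊑-trans (v (suc j)) (v zero) t
      (⊑-trans (v (suc j)) (v zero ⊕ (0ℤ , 1ℤ)) (v zero) vj⊑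
        (subst Positive (sym (⊕-⊖-shift (v zero) (0ℤ , 1ℤ))) (+≤+ ℕ.z≤n))) v0⊑t)
  }

greatestBelow : ∀ {n} (v : Fin n → ℤ²) t →
                (∀ j → ¬ v j ⊑ t) ⊎ ∃[ j ] v j ⊑ t × ∀ i → v i ⊑ t → v i ⊑ v j
greatestBelow {zero}  v t = inj₁ λ ()
greatestBelow {suc n} v t with v zero ⊑? t | greatestBelow (v ∘ suc) t
... | no v0⋢t  | inj₁ none = inj₁ λ { zero → v0⋢t ; (suc j) → none j }
... | yes v0⊑t | inj₁ none = inj₂ (zero , v0⊑t , λ { zero _ → ⊑-refl (v zero) ; (suc i) vi⊑t →
  contradiction vi⊑t (none i) })
... | no v0⋢t  | inj₂ (j , vj⊑t , max) =
  inj₂ (suc j , vj⊑t , λ { zero v0⊑t → contradiction v0⊑t v0⋢t ; (suc i) → max i })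
... | yes v0⊑t | inj₂ (j , vj⊑t , max) with ⊑-total (v zero) (v (suc j))
... | inj₁ v0⊑vj = inj₂ (suc j , vj⊑t , λ { zero _ → v0⊑vj ; (suc i) → max i })
... | inj₂ vj⊑v0 = inj₂ (zero , v0⊑t , λ { zero _ → ⊑-refl (v zero) ; (suc i) vi⊑t →
  ⊑-trans (v (suc i)) (v (suc j)) (v zero) (max i vi⊑t) vj⊑v0 })

SameGap : ∀ {n} (v : Fin n → ℤ²) → ℤ² → ℤ² → Set
SameGap v t u = ∀ j → v j ⊑ t ⇔ v j ⊑ u

module _ {n} (v : Fin n → ℤ²) where
  -- One representative for the gap below all the points, and one for each gap that begins at some
  -- `v j`, namely that point itself. This accounts for the `+ 1` in the complexity.
  gapPoint : Fin (suc n) → ℤ²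
  gapPoint zero    = proj₁ (lowerPoint v)
  gapPoint (suc j) = v j

  gapPoint-covers : ∀ t → ∃[ i ] SameGap v t (gapPoint i)
  gapPoint-covers t with greatestBelow v t
  ... | inj₁ none = zero , λ j → mk⇔ (λ p → contradiction p (none j))
    (λ p → contradiction p (proj₂ (lowerPoint v) j))
  -- The gap of `t` begins at the greatest `v i` below `t`.
  ... | inj₂ (i , vi⊑t , max) = suc i , λ j → mk⇔ (max j) (λ vj⊑vi → ⊑-trans (v j) (v i) t vj⊑vi vi⊑t)

  -- Two of the points in the same gap lie below each other, so antisymmetry identifies them.
  gapPoint-distinct : (∀ {i j} → v i ≡ v j → i ≡ j) → ∀ {i j} → SameGap v (gapPoint i) (gapPoint j) →
    i ≡ j
  gapPoint-distinct inj {zero}  {zero}  _ = refl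
  gapPoint-distinct inj {zero}  {suc j} s =
    contradiction (Equivalence.from (s j) (⊑-refl (v j))) (proj₂ (lowerPoint v) j)
  gapPoint-distinct inj {suc i} {zero}  s =
    contradiction (Equivalence.to (s i) (⊑-refl (v i))) (proj₂ (lowerPoint v) i)
  gapPoint-distinct inj {suc i} {suc j} s = cong suc (inj (⊑-antisym (v i) (v j)
    (Equivalence.to (s i) (⊑-refl (v i))) (Equivalence.from (s j) (⊑-refl (v j)))))

-- The word

-- Upwards in the lattice only: in the order `⊑` these shifts go down.
up : ∀ {m} → Fin m → ℤ²
up h = 0ℤ , + toℕ h

χ : ℤ² → ℕ
χ z = indicator (does (positive? z))

χ-mono : ∀ z w → (Positive z → Positive w) → χ z ℕ.≤ χ w
χ-mono z w f with positive? z | positive? w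
... | no _  | _      = ℕ.z≤n
... | yes _ | yes _  = ℕₚ.≤-refl
... | yes p | no w≱0 = contradiction (f p) w≱0

χ-cong : ∀ z w → Positive z ⇔ Positive w → χ z ≡ χ w
χ-cong z w e = ℕₚ.≤-antisym (χ-mono z w (Equivalence.to e)) (χ-mono w z (Equivalence.from e))

χ-≡⇒⇔ : ∀ z w → χ z ≡ χ w → Positive z ⇔ Positive w
χ-≡⇒⇔ z w eq with positive? z | positive? w
χ-≡⇒⇔ z w eq | no p  | no q  = mk⇔ (λ p′ → contradiction p′ p) (λ q′ → contradiction q′ q)
χ-≡⇒⇔ z w eq | yes p | yes q = mk⇔ (λ _ → q) (λ _ → p)
χ-≡⇒⇔ z w () | yes _ | no _
χ-≡⇒⇔ z w () | no _  | yes _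

Positive-vertical : ∀ {e} → e ℤ.≤ 0ℤ → Positive (0ℤ , e)
Positive-vertical {+ zero}   _ = ℤₚ.≤-refl
Positive-vertical { -[1+ _ ]} _ = +≤+ ℕ.z≤n
Positive-vertical {+ suc _} (+≤+ ())

¬Positive-vertical : ∀ {e} → 0ℤ ℤ.< e → ¬ Positive (0ℤ , e)
¬Positive-vertical {+ suc _}  _ ()
¬Positive-vertical {+ zero}   (ℤ.+<+ ())

Box⇒∣a∣≤ : ∀ {N a} → ℤ.- (+ N) ℤ.≤ a → a ℤ.≤ + N → ℤ.∣ a ∣ ℕ.≤ N
Box⇒∣a∣≤ {a = + _}      _ (+≤+ a≤N) = a≤N
Box⇒∣a∣≤ {suc N} { -[1+ _ ]} (-≤- a≤N) _ = ℕ.s≤s a≤N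

module _ (m : ℕ) where

  level : ℤ² → ℕ
  level z = sum {m} (λ h → χ (z ⊕ up h))

  level≤m : ∀ z → level z ℕ.≤ m
  level≤m z = sum≤ {m} (λ h → indicator≤1 (does (positive? (z ⊕ up h))))

  word : Word (Fin (suc m))
  word z = fromℕ< (ℕ.s≤s (level≤m z))

  toℕ-word : ∀ z → toℕ (word z) ≡ level z
  toℕ-word z = Finₚ.toℕ-fromℕ< (ℕ.s≤s (level≤m z))

  level-cong : ∀ z w → (∀ h → Positive (z ⊕ up {m} h) ⇔ Positive (w ⊕ up h)) → level z ≡ level w
  level-cong z w e = sum-cong-≗ {m} (λ h → χ-cong (z ⊕ up h) (w ⊕ up h) (e h))

  word-cong : ∀ z w → (∀ h → Positive (z ⊕ up {m} h) ⇔ Positive (w ⊕ up h)) → word z ≡ word w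
  word-cong z w e = Finₚ.toℕ-injective
    (trans (toℕ-word z) (trans (level-cong z w e) (sym (toℕ-word w))))

  level-summand-mono : ∀ t u → t ⊑ u → ∀ h → χ (t ⊕ up {m} h) ℕ.≤ χ (u ⊕ up h)
  level-summand-mono t u t⊑u h = χ-mono (t ⊕ up h) (u ⊕ up h) (⊑⇒Positive t u t⊑u (up h))

  ⊑⇒level≤ : ∀ t u → t ⊑ u → level t ℕ.≤ level u
  ⊑⇒level≤ t u t⊑u = sum-mono {m} (level-summand-mono t u t⊑u)

  ⊑∧level≡⇒⇔ : ∀ t u → t ⊑ u → level t ≡ level u → ∀ h → Positive (t ⊕ up {m} h) ⇔ Positive (u ⊕ up h)
  ⊑∧level≡⇒⇔ t u t⊑u eq h =
    χ-≡⇒⇔ (t ⊕ up h) (u ⊕ up h) (sum-≤-≡⇒≗ {m} (level-summand-mono t u t⊑u) eq h)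

  -- The letters of the S-factor at t change precisely when t crosses one of these points.
  threshold : ∀ {k} → Vec ℤ² k → Fin m → Fin k → ℤ²
  threshold S h i = ⊖ (lookup S i ⊕ up h)

  thresholds : ∀ {k} → Vec ℤ² k → Fin (m ℕ.* k) → ℤ²
  thresholds {k} S j = threshold S (proj₁ (remQuot k j)) (proj₂ (remQuot {m} k j))

  threshold⊑⇔ : ∀ {k} (S : Vec ℤ² k) h i t → threshold S h i ⊑ t ⇔ Positive ((t ⊕ lookup S i) ⊕ up h)
  threshold⊑⇔ S h i t = mk⇔ (subst Positive eq) (subst Positive (sym eq))
    where eq = ⊕-⊖-⊖ t (lookup S i) (up h)

  -- Abelian classes of `S`-factors correspond to gaps between thresholds

  module _ {k} (S : FinSet k) where
    private
      pts = proj₁ S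

    lookup-factor : ∀ t i → lookup (factor word S t) i ≡ word (t ⊕ lookup pts i)
    lookup-factor t i = Vecₚ.lookup-map i _ pts

    SameGap⇒⇔ : ∀ t u → SameGap (thresholds pts) t u → ∀ i h →
      Positive ((t ⊕ lookup pts i) ⊕ up h) ⇔ Positive ((u ⊕ lookup pts i) ⊕ up h)
    SameGap⇒⇔ t u same i h = ⇔.trans (⇔.sym (threshold⊑⇔ pts h i t)) (⇔.trans
      (subst (λ (h , i) → threshold pts h i ⊑ t ⇔ threshold pts h i ⊑ u) (Finₚ.remQuot-combine h i)
        (same (combine h i)))
      (threshold⊑⇔ pts h i u))

    -- The factors are in fact equal, as each letter is determined by which thresholds lie below the
    -- position.
    SameGap⇒AbelianEquivalent : ∀ t u → SameGap (thresholds pts) t u →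
      AbelianEquivalent (factor word S t) (factor word S u)
    SameGap⇒AbelianEquivalent t u same a =
      cong (Vec.count (a Fin.≟_)) (trans (sym (Vecₚ.tabulate∘lookup (factor word S t)))
        (trans (Vecₚ.tabulate-cong factors≡) (Vecₚ.tabulate∘lookup (factor word S u))))
      where
      factors≡ : ∀ i → lookup (factor word S t) i ≡ lookup (factor word S u) i
      factors≡ i = trans (lookup-factor t i)
        (trans (word-cong (t ⊕ lookup pts i) (u ⊕ lookup pts i) (SameGap⇒⇔ t u same i))
          (sym (lookup-factor u i)))

    letterSum-factor : ∀ t → letterSum (factor word S t) ≡ sum (λ i → level (t ⊕ lookup pts i))
    letterSum-factor t = sum-cong-≗ {k} (λ i →
      trans (cong toℕ (lookup-factor t i)) (toℕ-word (t ⊕ lookup pts i)))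

    -- Levels increase along ⊑, so factors with the same sum of letters agree everywhere.
    ⊑∧AbelianEquivalent⇒SameGap : ∀ t u → t ⊑ u →
      AbelianEquivalent (factor word S t) (factor word S u) → SameGap (thresholds pts) t u
    ⊑∧AbelianEquivalent⇒SameGap t u t⊑u t≈u j =
      ⇔.trans (threshold⊑⇔ pts h i t) (⇔.trans
        (⊑∧level≡⇒⇔ (t ⊕ lookup pts i) (u ⊕ lookup pts i) (⊑-⊕ t u (lookup pts i) t⊑u) (levels≡ i) h)
        (⇔.sym (threshold⊑⇔ pts h i u)))
      where
      h = proj₁ (remQuot k j)
      i = proj₂ (remQuot {m} k j)
      levels≡ : ∀ i → level (t ⊕ lookup pts i) ≡ level (u ⊕ lookup pts i)
      levels≡ = sum-≤-≡⇒≗ {k} (λ i → ⊑⇒level≤ (t ⊕ lookup pts i) (u ⊕ lookup pts i)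
        (⊑-⊕ t u (lookup pts i) t⊑u))
        (trans (sym (letterSum-factor t)) (trans
          (AbelianEquivalent⇒letterSum≡ {u = factor word S t} {factor word S u} t≈u)
            (letterSum-factor u)))

    AbelianEquivalent⇒SameGap : ∀ t u → AbelianEquivalent (factor word S t) (factor word S u) →
      SameGap (thresholds pts) t u
    AbelianEquivalent⇒SameGap t u t≈u with ⊑-total t u
    ... | inj₁ t⊑u = ⊑∧AbelianEquivalent⇒SameGap t u t⊑u t≈u
    ... | inj₂ u⊑t = λ j → ⇔.sym (⊑∧AbelianEquivalent⇒SameGap u t u⊑t (λ a → sym (t≈u a)) j)

    gapPoint-abelian : ∀ t → ∃[ i ] AbelianEquivalent (factor word S t)
      (factor word S (gapPoint (thresholds pts) i))
    gapPoint-abelian t with i , same ← gapPoint-covers (thresholds pts) t =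
      i , SameGap⇒AbelianEquivalent t (gapPoint (thresholds pts) i) same

    complexity : ∃[ n ] n ∈ AbelianComplexity word S
    complexity = covered⇒finite (AbelianClasses word S)
      (λ t u → abelianEquivalent? (factor word S t) (factor word S u))
      (gapPoint (thresholds pts)) gapPoint-abelian

    complexity≤ : ∀ {n} → n ∈ AbelianComplexity word S → n ℕ.≤ suc (m ℕ.* k)
    complexity≤ bij = covered⇒≤ (AbelianClasses word S) bij (gapPoint (thresholds pts)) gapPoint-abelian

  -- Horizontal segments attain the upper bound

  segment : ∀ k → FinSet k
  segment k = Vec.tabulate (λ i → + toℕ i , 0ℤ) , tabulate⁺
    (λ eq → Finₚ.toℕ-injective (ℤₚ.+-injective (cong proj₁ eq)))

  -- The points of the segment differ horizontally and the shifts `up h` vertically, so the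
  -- threshold `(- i , - h)` reveals both `i` and `h`.
  thresholds-segment-injective : ∀ k {i j} →
    thresholds (proj₁ (segment k)) i ≡ thresholds (proj₁ (segment k)) j → i ≡ j
  thresholds-segment-injective k {i} {j} eq =
    trans (sym (Finₚ.combine-remQuot {m} k i))
      (trans (cong₂ combine h≡ i≡) (Finₚ.combine-remQuot {m} k j))
    where
    pt : ∀ h i → threshold (proj₁ (segment k)) h i ≡ (ℤ.- + toℕ i , ℤ.- + toℕ h)
    pt h i = trans (cong (λ s → ⊖ (s ⊕ up h)) (Vecₚ.lookup∘tabulate _ i))
      (cong₂ _,_ (cong ℤ.-_ (ℤₚ.+-identityʳ (+ toℕ i))) (cong ℤ.-_ (ℤₚ.+-identityˡ (+ toℕ h))))
    eq′ : _≡_ {A = ℤ²} _ _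
    eq′ = trans (sym (pt (proj₁ (remQuot k i)) (proj₂ (remQuot {m} k i))))
      (trans eq (pt (proj₁ (remQuot k j)) (proj₂ (remQuot {m} k j))))
    i≡ : proj₂ (remQuot {m} k i) ≡ proj₂ (remQuot {m} k j)
    i≡ = Finₚ.toℕ-injective (ℤₚ.+-injective (ℤₚ.neg-injective (cong proj₁ eq′)))
    h≡ : proj₁ (remQuot {m} k i) ≡ proj₁ (remQuot {m} k j)
    h≡ = Finₚ.toℕ-injective (ℤₚ.+-injective (ℤₚ.neg-injective (cong proj₂ eq′)))

  segment-complexity≥ : ∀ k {n} → n ∈ AbelianComplexity word (segment k) → suc (m ℕ.* k) ℕ.≤ n
  segment-complexity≥ k bij = inequivalent⇒≤ (AbelianClasses word (segment k)) bij (gapPoint v)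
    (λ {i} {j} eq → gapPoint-distinct v (thresholds-segment-injective k)
       (AbelianEquivalent⇒SameGap (segment k) (gapPoint v i) (gapPoint v j) eq))
    where v = thresholds (proj₁ (segment k))

  maximalPatternComplexity : ∀ k → suc (m ℕ.* k) ∈ AbelianMaximalPatternComplexity word k
  maximalPatternComplexity k =
    complexity ,
    (λ n (S , bij) → complexity≤ S bij) ,
    (λ M bound → ℕₚ.≤-trans (segment-complexity≥ k (proj₂ (complexity (segment k))))
      (bound _ (segment k , proj₂ (complexity (segment k)))))

  -- Periods

  -- Supplies, for each nonzero letter, a position where one of the counted points (`h = n`) is the
  -- origin and thus only just positive.
  level-column : ∀ n → n ℕ.< m → level (0ℤ , ℤ.- + n) ≡ suc n
  level-column n n<m = trans (sum-cong-≗ {m} (λ h → summand (toℕ h))) (sum-≤ᵇ n<m)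
    where
    summand : ∀ h → χ ((0ℤ , ℤ.- + n) ⊕ (0ℤ , + h)) ≡ indicator (h ℕ.≤ᵇ n)
    summand h with positive? (0ℤ , ℤ.- + n ℤ.+ + h) | h ℕ.≤ᵇ n in eq
    ... | yes _ | true  = refl
    ... | no _  | false = refl
    ... | yes p | false = contradiction p
      (¬Positive-vertical (subst (ℤ._< ℤ.- + n ℤ.+ + h) (ℤₚ.+-inverseˡ (+ n))
      (ℤₚ.+-monoʳ-< (ℤ.- + n) (ℤ.+<+ (ℕₚ.≰⇒> λ h≤n → subst T eq (ℕₚ.≤⇒≤ᵇ h≤n))))))
    ... | no ¬p | true  = contradiction (Positive-vertical
      (subst (ℤ.- + n ℤ.+ + h ℤ.≤_) (ℤₚ.+-inverseˡ (+ n))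
      (ℤₚ.+-monoʳ-≤ (ℤ.- + n) (+≤+ (ℕₚ.≤ᵇ⇒≤ h n (subst T (sym eq) _)))))) ¬p

  -- Induction on the letter: a nonzero letter is found at a position `z` where a counted point is
  -- the origin. Going down from `z` by the period keeps the projection but lowers the letter.
  periodic⇒constant : ∀ (B : Subset (suc m)) p → p ∈ H B word → Positive p → p ≢ 0² → ∀ a →
    lookup B a ≡ lookup B zero
  periodic⇒constant B p period p≥0 p≢0 a = go (toℕ a) a ℕₚ.≤-refl
    where
    go : ∀ n (a : Fin (suc m)) → toℕ a ℕ.≤ n → lookup B a ≡ lookup B zero
    go zero    zero a≤n = refl
    go (suc n) a a≤n with ℕₚ.m≤n⇒m<n∨m≡n a≤n
    ... | inj₁ (ℕ.s≤s a≤n′) = go n a a≤n′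
    ... | inj₂ a≡suc = begin
      lookup B a
        ≡⟨ cong (lookup B) (Finₚ.toℕ-injective (trans a≡suc (sym (trans (toℕ-word z) level-z)))) ⟩
      lookup B (word z)        ≡⟨ cong (lookup B ∘ word) (⊕-cancel z p) ⟨
      lookup B (word (t ⊕ p))  ≡⟨ period t ⟩
      lookup B (word t)
        ≡⟨ go n (word t) (ℕₚ.≤-trans (ℕₚ.≤-reflexive (toℕ-word t))
          (ℕ.s≤s⁻¹ (ℕₚ.<-≤-trans level-t< (ℕₚ.≤-reflexive level-z)))) ⟩
      lookup B zero                 ∎
      where
      open ≡-Reasoning
      n<m : n ℕ.< m
      n<m = ℕ.s≤s⁻¹ (ℕₚ.≤-trans (ℕ.s≤s (ℕₚ.≤-reflexive (sym a≡suc))) (Finₚ.toℕ<n a))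
      z t : ℤ²
      z = 0ℤ , ℤ.- + n
      t = z ⊕ ⊖ p
      level-z : level z ≡ suc n
      level-z = level-column n n<m
      t⊑z : t ⊑ z
      t⊑z = subst Positive (sym (trans (⊕-⊖-shift z (⊖ p)) (⊖-involutive p))) p≥0
      z+up : z ⊕ up (fromℕ< n<m) ≡ 0²
      z+up = cong (0ℤ ,_) (trans (cong (λ k → ℤ.- + n ℤ.+ + k) (Finₚ.toℕ-fromℕ< n<m))
        (ℤₚ.+-inverseˡ (+ n)))
      -- Equal levels would make `⊖ p`, the translate of the origin, positive as well, which forces
      -- `p` to be zero.
      level-t< : level t ℕ.< level z
      level-t< = ℕₚ.≤∧≢⇒< (⊑⇒level≤ t z t⊑z) λ eq →
        p≢0 (Positive-antisym p p≥0 (subst Positive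
          (trans (⊕-swap z (⊖ p) (up (fromℕ< n<m))) (trans (cong (_⊕ ⊖ p) z+up) (⊕-identityˡ (⊖ p))))
            (Equivalence.from (⊑∧level≡⇒⇔ t z t⊑z eq (fromℕ< n<m))
              (subst Positive (sym z+up) Positive-0²))))

  periodic⇒constant± : ∀ (B : Subset (suc m)) p → p ∈ H B word → p ≢ 0² → ∀ a →
    lookup B a ≡ lookup B zero
  periodic⇒constant± B p period p≢0 with Positive-total p
  ... | inj₁ p≥0  = periodic⇒constant B p period p≥0 p≢0
  ... | inj₂ -p≥0 = periodic⇒constant B (⊖ p) -period -p≥0
    (λ eq → p≢0 (trans (sym (⊖-involutive p)) (cong ⊖_ eq)))
    where
    -period : ⊖ p ∈ H B word
    -period t = trans (sym (period (t ⊕ ⊖ p))) (cong (lookup B ∘ word) (⊕-cancel t p))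

  H≐｛0²｝ : ∀ B → Proper B → H B word ≐ ｛ 0² ｝
  H≐｛0²｝ B ((a , a∈B) , _ , b , _ , b∉B) =
    only-0² , λ { refl t → cong (lookup B ∘ word) (⊕-identityʳ t) }
    where
    only-0² : ∀ {p} → p ∈ H B word → 0² ≡ p
    only-0² {p} period with ≡-dec ℤ._≟_ ℤ._≟_ p 0²
    ... | yes p≡0 = sym p≡0
    ... | no p≢0  = contradiction (Vecₚ.lookup⇒[]= b B
      (trans (constant b) (trans (sym (constant a)) (Vecₚ.[]=⇒lookup a∈B)))) b∉B
      where constant = periodic⇒constant± B p period p≢0

  nonDoublyPeriodic : NonDoublyPeriodicByProjection word
  nonDoublyPeriodic B proper (p , q , p∈H , _ , indep)
    with refl ← proj₁ (H≐｛0²｝ B proper) p∈H =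
    -- With `p ≡ 0²` the coefficients 1 and 0 give a nontrivial relation.
    contradiction (proj₁ (indep 1ℤ 0ℤ (cong₂ _,_ (ℤₚ.*-zeroˡ (proj₁ q)) (ℤₚ.*-zeroˡ (proj₂ q))))) λ ()

  -- Recurrence

  -- The shifts `up h` keep the first coordinate, so the bound `∣ a ∣ ≤ N ≤ j < den j` serves all
  -- counted points at once.
  word-recurrent : ∀ {N j} → N ℕ.≤ j → ∀ z → z ∈ Box N → word (z ⊕ kernelPoint (suc j)) ≡ word z
  word-recurrent {N} {j} N≤j z@(a , _) ((-N≤a , a≤N) , _) = word-cong (z ⊕ q) z λ h →
    subst (λ w → Positive w ⇔ Positive (z ⊕ up h)) (⊕-swap z (up h) q)
      (Positive-recurrent j (z ⊕ up h) (subst (λ c → ℤ.∣ c ∣ ℕ.< den j) (sym (ℤₚ.+-identityʳ a))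
        (ℕₚ.≤-<-trans (ℕₚ.≤-trans (Box⇒∣a∣≤ -N≤a a≤N) N≤j) (j<den j))))
    where q = kernelPoint (suc j)

-- Rational arithmetic

module _ where
  open import Data.Rational using (_+_; _*_; _-_; -_; ∣_∣; _≤_; _<_)
  open +-*-Solver using (solve; _:=_; _:+_; _:*_; _:-_; :-_; con)

  -- Reduces an inequality to a known one and a ring identity, which the solver can check.
  ≤-by-difference : ∀ {p q r s} → p ≤ q → s - r ≡ q - p → r ≤ s
  ≤-by-difference {p} {q} {r} {s} p≤q eq = begin
    r            ≡⟨ solve 2 (λ r p → r := p :+ (r :- p)) refl r p ⟩
    p + (r - p)  ≤⟨ ℚₚ.+-monoˡ-≤ (r - p) p≤q ⟩
    q + (r - p)  ≡⟨ solve 3 (λ q r p → q :+ (r :- p) := (q :- p) :+ r) refl q r p ⟩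
    (q - p) + r  ≡⟨ cong (_+ r) eq ⟨
    (s - r) + r  ≡⟨ solve 2 (λ s r → (s :- r) :+ r := s) refl s r ⟩
    s            ∎
    where open ℚₚ.≤-Reasoning

  *-mono-≤ : ∀ {p q r s} → 0ℚ ≤ r → 0ℚ ≤ q → p ≤ q → r ≤ s → p * r ≤ q * s
  *-mono-≤ {p} {q} {r} {s} 0≤r 0≤q p≤q r≤s = ℚₚ.≤-trans
    (ℚₚ.*-monoʳ-≤-nonNeg r {{ℚ.nonNegative 0≤r}} p≤q)
    (ℚₚ.*-monoˡ-≤-nonNeg q {{ℚ.nonNegative 0≤q}} r≤s)

  0≤* : ∀ {p q} → 0ℚ ≤ p → 0ℚ ≤ q → 0ℚ ≤ p * q
  0≤* {p} {q} 0≤p 0≤q = subst (_≤ p * q) (ℚₚ.*-zeroʳ p)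
    (ℚₚ.*-monoˡ-≤-nonNeg p {{ℚ.nonNegative 0≤p}} 0≤q)

  0<* : ∀ {p q} → 0ℚ < p → 0ℚ < q → 0ℚ < p * q
  0<* {p} {q} 0<p 0<q = subst (_< p * q) (ℚₚ.*-zeroʳ p) (ℚₚ.*-monoʳ-<-pos p {{ℚ.positive 0<p}} 0<q)

  ∣*∣≤ : ∀ {p q r s} → ∣ p ∣ ≤ q → ∣ r ∣ ≤ s → ∣ p * r ∣ ≤ q * s
  ∣*∣≤ {p} {q} {r} {s} p≤q r≤s = subst (_≤ q * s) (sym (ℚₚ.∣p*q∣≡∣p∣*∣q∣ p r))
    (*-mono-≤ (ℚₚ.0≤∣p∣ r) (ℚₚ.≤-trans (ℚₚ.0≤∣p∣ p) p≤q) p≤q r≤s)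

  ∣+∣≤ : ∀ {p q r s} → ∣ p ∣ ≤ q → ∣ r ∣ ≤ s → ∣ p + r ∣ ≤ q + s
  ∣+∣≤ {p} {r = r} p≤q r≤s = ℚₚ.≤-trans (ℚₚ.∣p+q∣≤∣p∣+∣q∣ p r) (ℚₚ.+-mono-≤ p≤q r≤s)

  ∣-∣≤ : ∀ {p q r s} → ∣ p ∣ ≤ q → ∣ r ∣ ≤ s → ∣ p - r ∣ ≤ q + s
  ∣-∣≤ {p} {r = r} p≤q r≤s = ℚₚ.≤-trans (ℚₚ.∣p-q∣≤∣p∣+∣q∣ p r) (ℚₚ.+-mono-≤ p≤q r≤s)

  ∣-∣-comm : ∀ p q → ∣ p - q ∣ ≡ ∣ q - p ∣
  ∣-∣-comm p q = trans (cong ∣_∣ (solve 2 (λ p q → p :- q := :- (q :- p)) refl p q))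
    (ℚₚ.∣-p∣≡∣p∣ (q - p))

  -- Powers of one half and geometric tails

  half : ℕ → ℚ
  half zero    = 1ℚ
  half (suc n) = ½ * half n

  half-split : ∀ n → half n ≡ half (suc n) + half (suc n)
  half-split n = solve 1 (λ h → h := con ½ :* h :+ con ½ :* h) refl (half n)

  0≤half : ∀ n → 0ℚ ≤ half n
  0≤half zero    = ℚ.*≤* (+≤+ ℕ.z≤n)
  0≤half (suc n) = 0≤* {½} (ℚ.*≤* (+≤+ ℕ.z≤n)) (0≤half n)

  half-+ : ∀ m n → half (m ℕ.+ n) ≡ half m * half n
  half-+ zero    n = sym (ℚₚ.*-identityˡ (half n))
  half-+ (suc m) n = trans (cong (½ *_) (half-+ m n)) (sym (ℚₚ.*-assoc ½ (half m) (half n)))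

  half≤1 : ∀ n → half n ≤ 1ℚ
  half≤1 zero    = ℚₚ.≤-refl
  half≤1 (suc n) = ℚₚ.≤-trans (≤-by-difference (0≤half (suc n))
    (solve 1 (λ h → h :- con ½ :* h := con ½ :* h :- con 0ℚ) refl (half n))) (half≤1 n)

  half-antimono : ∀ {m n} → m ℕ.≤ n → half n ≤ half m
  half-antimono {m} m≤n with ℕₚ.m≤n⇒∃[o]m+o≡n m≤n
  ... | o , refl = begin
    half (m ℕ.+ o)   ≡⟨ half-+ m o ⟩
    half m * half o  ≤⟨ ℚₚ.*-monoˡ-≤-nonNeg (half m) {{ℚ.nonNegative (0≤half m)}} (half≤1 o) ⟩
    half m * 1ℚ      ≡⟨ ℚₚ.*-identityʳ (half m) ⟩
    half m           ∎
    where open ℚₚ.≤-Reasoning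

  half≤1/suc : ∀ n → ℚ.toℚᵘ (half n) ℚᵘ.≤ mkℚᵘ (+ 1) n
  half≤1/suc zero    = ℚᵘₚ.≤-refl
  half≤1/suc (suc n) = begin
    ℚ.toℚᵘ (½ * half n)                ≃⟨ ℚₚ.toℚᵘ-homo-* ½ (half n) ⟩
    mkℚᵘ (+ 1) 1 ℚᵘ.* ℚ.toℚᵘ (half n)  ≤⟨ ℚᵘₚ.*-monoʳ-≤-nonNeg (mkℚᵘ (+ 1) 1) (half≤1/suc n) ⟩
    mkℚᵘ (+ 1) 1 ℚᵘ.* mkℚᵘ (+ 1) n     ≤⟨ ℚᵘ.*≤* (+≤+ (bound n))  ⟩
    mkℚᵘ (+ 1) (suc n)                 ∎
    where
    open ℚᵘₚ.≤-Reasoning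
    bound : ∀ n → 1 ℕ.* suc (suc n) ℕ.≤ 1 ℕ.* (2 ℕ.* suc n)
    bound n = ℕₚ.*-monoʳ-≤ 1 (ℕ.s≤s (ℕₚ.≤-trans (ℕₚ.≤-reflexive (sym (ℕₚ.*-identityˡ (suc n))))
      (ℕₚ.m≤n+m (1 ℕ.* suc n) n)))

  archimedean : ∀ {ε} → 0ℚ < ε → ∃[ n ] half n < ε
  archimedean {mkℚ (+ zero) d _}  (ℚ.*<* (ℤ.+<+ ()))
  -- The stored `d` stands for the denominator `d + 1`, and
  -- `half (d + 1) ≤ 1/(d + 2) < 1/(d + 1) ≤ ε`.
  archimedean {mkℚ (+ suc p) d _} _ = suc d , ℚₚ.toℚᵘ-cancel-< (ℚᵘₚ.≤-<-trans (half≤1/suc (suc d))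
    (ℚᵘ.*<* (ℤ.+<+ (ℕₚ.≤-<-trans (ℕₚ.≤-reflexive (ℕₚ.*-identityˡ (suc d)))
      (ℕₚ.<-≤-trans (ℕₚ.n<1+n (suc d)) (ℕₚ.m≤n*m (suc (suc d)) (suc p)))))))
  archimedean {mkℚ -[1+ _ ] d _} (ℚ.*<* ())

  -- The term `c * half (k + M)` is the geometric tail still available to later increments; keeping
  -- it in the statement lets the induction close.
  telescope : ∀ (s : ℕ → ℚ) c → (∀ n → ∣ s (suc n) - s n ∣ ≤ c * half (suc n)) →
              ∀ M k → ∣ s (k ℕ.+ M) - s M ∣ + c * half (k ℕ.+ M) ≤ c * half M
  telescope s c Δ≤ M zero    = ℚₚ.≤-reflexive
    (trans (cong (λ d → ∣ d ∣ + c * half M) (ℚₚ.+-inverseʳ (s M))) (ℚₚ.+-identityˡ (c * half M)))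
  telescope s c Δ≤ M (suc k) = begin
    ∣ s (suc n) - s M ∣ + c * half (suc n)
      ≡⟨ cong (λ d → ∣ d ∣ + c * half (suc n))
        (solve 3 (λ x y z → x :- z := (x :- y) :+ (y :- z)) refl (s (suc n)) (s n) (s M)) ⟩
    ∣ (s (suc n) - s n) + (s n - s M) ∣ + c * half (suc n)
      ≤⟨ ℚₚ.+-monoˡ-≤ (c * half (suc n)) (∣+∣≤ (Δ≤ n) ℚₚ.≤-refl) ⟩
    (c * half (suc n) + ∣ s n - s M ∣) + c * half (suc n)
      ≡⟨ solve 3 (λ c d h → (c :* (con ½ :* h) :+ d) :+ c :* (con ½ :* h) := d :+ c :* h)
        refl c ∣ s n - s M ∣ (half n) ⟩
    ∣ s n - s M ∣ + c * half n
      ≤⟨ telescope s c Δ≤ M k ⟩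
    c * half M ∎
    where
    open ℚₚ.≤-Reasoning
    n = k ℕ.+ M

  telescope≤ : ∀ (s : ℕ → ℚ) c → 0ℚ ≤ c → (∀ n → ∣ s (suc n) - s n ∣ ≤ c * half (suc n)) →
               ∀ {M n} → M ℕ.≤ n → ∣ s n - s M ∣ ≤ c * half M
  telescope≤ s c 0≤c Δ≤ {M} {n} M≤n with ℕₚ.m≤n⇒∃[o]m+o≡n M≤n
  ... | k , refl with ℕₚ.+-comm M k
  ... | eq = subst (λ n → ∣ s n - s M ∣ ≤ c * half M) (sym eq) (ℚₚ.≤-trans
    (≤-by-difference (0≤* 0≤c (0≤half (k ℕ.+ M)))
      (solve 2 (λ d h → (d :+ h) :- d := h :- con 0ℚ) refl ∣ s (k ℕ.+ M) - s M ∣ (c * half (k ℕ.+ M))))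
    (telescope s c Δ≤ M k))

  telescope⇒cauchy : ∀ (s : ℕ → ℚ) → (∀ n → ∣ s (suc n) - s n ∣ ≤ 1ℚ * half (suc n)) →
    ∀ ε → 0ℚ < ε → ∃[ M ] ∀ m n → M ℕ.≤ m → M ℕ.≤ n → ∣ s m - s n ∣ < ε
  telescope⇒cauchy s Δ≤ ε 0<ε with archimedean 0<ε
  ... | M , halfM<ε = suc M , λ m n M≤m M≤n → ℚₚ.≤-<-trans (close m n M≤m M≤n) halfM<ε
    where
    close : ∀ m n → suc M ℕ.≤ m → suc M ℕ.≤ n → ∣ s m - s n ∣ ≤ half M
    close m n M≤m M≤n = begin
      ∣ s m - s n ∣
        ≡⟨ cong ∣_∣ (solve 3 (λ x y z → x :- y := (x :- z) :+ (z :- y)) refl (s m) (s n) (s (suc M))) ⟩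
      ∣ (s m - s (suc M)) + (s (suc M) - s n) ∣
        ≤⟨ ∣+∣≤ (telescope≤ s 1ℚ (0≤half 0) Δ≤ M≤m)
          (subst (_≤ 1ℚ * half (suc M)) (∣-∣-comm (s n) (s (suc M)))
            (telescope≤ s 1ℚ (0≤half 0) Δ≤ M≤n)) ⟩
      1ℚ * half (suc M) + 1ℚ * half (suc M)
        ≡⟨ solve 1 (λ h → con 1ℚ :* (con ½ :* h) :+ con 1ℚ :* (con ½ :* h) := h) refl (half M) ⟩
      half M                                         ∎
      where open ℚₚ.≤-Reasoning

  -- The functions sin and cos

  sinTerm cosTerm : ℚ → ℕ → ℚ
  sinTerm y k = ((- 1ℚ) ^ k) * (y ^ suc (2 ℕ.* k)) * 1/ (suc (2 ℕ.* k)) !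
  cosTerm y k = ((- 1ℚ) ^ k) * (y ^ (2 ℕ.* k)) * 1/ (2 ℕ.* k) !

  ∣1/n∣≤1 : ∀ n .{{_ : ℕ.NonZero n}} → ∣ + 1 ℚ./ n ∣ ≤ 1ℚ
  ∣1/n∣≤1 (suc n) = ℚₚ.toℚᵘ-cancel-≤ (begin
    ℚ.toℚᵘ ∣ + 1 ℚ./ suc n ∣       ≃⟨ ℚₚ.toℚᵘ-homo-∣-∣ (+ 1 ℚ./ suc n) ⟩
    ℚᵘ.∣ ℚ.toℚᵘ (+ 1 ℚ./ suc n) ∣  ≃⟨ ℚᵘₚ.∣-∣-cong (ℚₚ.toℚᵘ-fromℚᵘ (mkℚᵘ (+ 1) n)) ⟩
    ℚᵘ.∣ mkℚᵘ (+ 1) n ∣            ≤⟨ ℚᵘ.*≤* (+≤+ (ℕ.s≤s ℕ.z≤n)) ⟩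
    ℚ.toℚᵘ 1ℚ                      ∎)
    where open ℚᵘₚ.≤-Reasoning

  ∣1/n!∣≤1 : ∀ n → ∣ 1/ n ! ∣ ≤ 1ℚ
  ∣1/n!∣≤1 n = ∣1/n∣≤1 (n ℕ.!) {{n ℕₚ.!≢0}}

  ∣[-1]^k∣≤1 : ∀ k → ∣ (- 1ℚ) ^ k ∣ ≤ 1ℚ
  ∣[-1]^k∣≤1 zero    = ℚₚ.≤-refl
  ∣[-1]^k∣≤1 (suc k) = ∣*∣≤ { - 1ℚ} {1ℚ} {(- 1ℚ) ^ k} ℚₚ.≤-refl (∣[-1]^k∣≤1 k)

  -- Signs and reciprocal factorials have absolute value at most 1, so the power alone bounds a
  -- Taylor term.
  ∣term∣≤ : ∀ k n {p q} → ∣ p ∣ ≤ q → ∣ ((- 1ℚ) ^ k) * p * 1/ n ! ∣ ≤ q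
  ∣term∣≤ k n {p} {q} p≤q = subst (∣ ((- 1ℚ) ^ k) * p * 1/ n ! ∣ ≤_)
    (solve 1 (λ q → con 1ℚ :* q :* con 1ℚ := q) refl q)
    (∣*∣≤ {((- 1ℚ) ^ k) * p} {1ℚ * q} {1/ n !} (∣*∣≤ {(- 1ℚ) ^ k} {1ℚ} {p} (∣[-1]^k∣≤1 k) p≤q)
      (∣1/n!∣≤1 n))

  ∣y^n∣≤ : ∀ {y c} → ∣ y ∣ ≤ half c → ∀ n → ∣ y ^ n ∣ ≤ half (n ℕ.* c)
  ∣y^n∣≤ y≤ zero    = ℚₚ.≤-refl
  ∣y^n∣≤ {y} {c} y≤ (suc n) = subst (∣ y ^ suc n ∣ ≤_) (sym (half-+ c (n ℕ.* c)))
    (∣*∣≤ {y} {half c} {y ^ n} y≤ (∣y^n∣≤ {y} {c} y≤ n))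

  -- The power has Lipschitz constant `(n + 1) / 8^n` on the interval of radius 1/8; the bound used
  -- is the larger `4^-n`, which reproduces itself under the product rule.
  ∣y^n-z^n∣≤ : ∀ {y z} → ∣ y ∣ ≤ half 3 → ∣ z ∣ ≤ half 3 → ∀ n →
               ∣ y ^ suc n - z ^ suc n ∣ ≤ half (n ℕ.* 2) * ∣ y - z ∣
  ∣y^n-z^n∣≤ {y} {z} y≤ z≤ zero = ℚₚ.≤-reflexive
    (trans (cong ∣_∣ (solve 2 (λ y z → y :* con 1ℚ :- z :* con 1ℚ := y :- z) refl y z))
      (sym (ℚₚ.*-identityˡ ∣ y - z ∣)))
  ∣y^n-z^n∣≤ {y} {z} y≤ z≤ (suc n) = begin
    ∣ y * Y - z * Z ∣
      ≡⟨ cong ∣_∣ (solve 4 (λ y z Y Z → y :* Y :- z :* Z := y :* (Y :- Z) :+ Z :* (y :- z))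
        refl y z Y Z) ⟩
    ∣ y * (Y - Z) + Z * (y - z) ∣
      ≤⟨ ∣+∣≤ (∣*∣≤ {y} {half 3} {Y - Z} y≤ (∣y^n-z^n∣≤ {y} {z} y≤ z≤ n))
        (∣*∣≤ {Z} {r = y - z} Z≤ ℚₚ.≤-refl) ⟩
    half 3 * (half (n ℕ.* 2) * e) + half (suc (suc (suc (n ℕ.* 2)))) * e
      ≡⟨ solve 2 (λ h e → con (half 3) :* (h :* e) :+ con ½ :* (con ½ :* (con ½ :* h)) :* e
        := con ½ :* (con ½ :* h) :* e) refl (half (n ℕ.* 2)) e ⟩
    half (suc (suc (n ℕ.* 2))) * e             ∎
    where
    open ℚₚ.≤-Reasoning
    Y = y ^ suc n
    Z = z ^ suc n
    e = ∣ y - z ∣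
    Z≤ : ∣ Z ∣ ≤ half (suc (suc (suc (n ℕ.* 2))))
    Z≤ = ℚₚ.≤-trans (∣y^n∣≤ {z} {3} z≤ (suc n))
      (half-antimono (ℕₚ.+-monoʳ-≤ 3 (ℕₚ.*-monoʳ-≤ n (ℕ.s≤s (ℕ.s≤s ℕ.z≤n)))))

  -- At `approx θ n` these are `sin θ n` and `cos θ n` by computation.
  sinSum cosSum : ℕ → ℚ → ℚ
  sinSum n y = ∑< n (sinTerm y)
  cosSum n y = ∑< n (cosTerm y)

  ∣cosTerm∣≤ : ∀ {y} → ∣ y ∣ ≤ half 3 → ∀ k → ∣ cosTerm y k ∣ ≤ half (2 ℕ.* k ℕ.* 3)
  ∣cosTerm∣≤ {y} y≤ k = ∣term∣≤ k (2 ℕ.* k) (∣y^n∣≤ {y} {3} y≤ (2 ℕ.* k))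

  ∣sinTerm∣≤ : ∀ {y} → ∣ y ∣ ≤ half 3 → ∀ k → ∣ sinTerm y k ∣ ≤ half (suc (2 ℕ.* k) ℕ.* 3)
  ∣sinTerm∣≤ {y} y≤ k = ∣term∣≤ k (suc (2 ℕ.* k)) (∣y^n∣≤ {y} {3} y≤ (suc (2 ℕ.* k)))

  -- The geometric tail `2 * half n` is reserved for the terms still to come.
  ∣cosSum∣≤2 : ∀ {y} → ∣ y ∣ ≤ half 3 → ∀ n → ∣ cosSum n y ∣ + (half n + half n) ≤ 1ℚ + 1ℚ
  ∣cosSum∣≤2 y≤ zero    = ℚₚ.≤-reflexive (ℚₚ.+-identityˡ (1ℚ + 1ℚ))
  ∣cosSum∣≤2 {y} y≤ (suc n) = begin
    ∣ cosSum n y + cosTerm y n ∣ + (half (suc n) + half (suc n))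
      ≤⟨ ℚₚ.+-mono-≤ (∣+∣≤ {cosSum n y} {r = cosTerm y n} ℚₚ.≤-refl
        (ℚₚ.≤-trans (∣cosTerm∣≤ {y} y≤ n) (half-antimono n≤))) (ℚₚ.≤-reflexive (sym (half-split n))) ⟩
    (∣ cosSum n y ∣ + half n) + half n  ≡⟨ ℚₚ.+-assoc ∣ cosSum n y ∣ (half n) (half n) ⟩
    ∣ cosSum n y ∣ + (half n + half n)  ≤⟨ ∣cosSum∣≤2 {y} y≤ n ⟩
    1ℚ + 1ℚ                             ∎
    where
    open ℚₚ.≤-Reasoning
    n≤ : n ℕ.≤ 2 ℕ.* n ℕ.* 3
    n≤ = ℕₚ.≤-trans (ℕₚ.m≤m+n n _) (ℕₚ.m≤m*n (2 ℕ.* n) 3)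

  ∣sinTerm-∣≤ : ∀ {y z} → ∣ y ∣ ≤ half 3 → ∣ z ∣ ≤ half 3 → ∀ k →
    ∣ sinTerm y k - sinTerm z k ∣ ≤ half (2 ℕ.* k ℕ.* 2) * ∣ y - z ∣
  ∣sinTerm-∣≤ {y} {z} y≤ z≤ k = subst (λ d → ∣ d ∣ ≤ half (2 ℕ.* k ℕ.* 2) * ∣ y - z ∣)
    (solve 4 (λ s p q f → s :* (p :- q) :* f := s :* p :* f :- s :* q :* f)
      refl ((- 1ℚ) ^ k) (y ^ suc (2 ℕ.* k)) (z ^ suc (2 ℕ.* k)) (1/ suc (2 ℕ.* k) !))
    (∣term∣≤ k (suc (2 ℕ.* k)) (∣y^n-z^n∣≤ {y} {z} y≤ z≤ (2 ℕ.* k)))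

  -- The constant term of index 0 cancels and is left out. The exponent `n + 1 * suc n` is the
  -- predecessor to which `2 * suc n` unfolds.
  ∣cosTerm-∣≤ : ∀ {y z} → ∣ y ∣ ≤ half 3 → ∣ z ∣ ≤ half 3 → ∀ n →
    ∣ cosTerm y (suc n) - cosTerm z (suc n) ∣ ≤ half ((n ℕ.+ 1 ℕ.* suc n) ℕ.* 2) * ∣ y - z ∣
  ∣cosTerm-∣≤ {y} {z} y≤ z≤ n = subst (λ d → ∣ d ∣ ≤ half ((n ℕ.+ 1 ℕ.* suc n) ℕ.* 2) * ∣ y - z ∣)
    (solve 4 (λ s p q f → s :* (p :- q) :* f := s :* p :* f :- s :* q :* f)
      refl ((- 1ℚ) ^ suc n) (y ^ (2 ℕ.* suc n)) (z ^ (2 ℕ.* suc n)) (1/ (2 ℕ.* suc n) !))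
    (∣term∣≤ (suc n) (2 ℕ.* suc n) (∣y^n-z^n∣≤ {y} {z} y≤ z≤ (n ℕ.+ 1 ℕ.* suc n)))

  -- The fixed points of y ↦ y - (sin y - τ cos y) are the y with tan y = τ.
  step : ℕ → ℚ → ℚ → ℚ
  step n τ y = y - (sinSum n y - τ * cosSum n y)

  -- With one Taylor term each, the sine is `y` and the cosine is 1. The estimates for `step` thus
  -- start from a constant map.
  step-1 : ∀ τ y → step 1 τ y ≡ τ
  step-1 = solve 2 (λ τ y → y :- ((con 0ℚ :+ con 1ℚ :* (y :* con 1ℚ) :* con 1ℚ)
    :- τ :* (con 0ℚ :+ con 1ℚ :* con 1ℚ :* con 1ℚ)) := τ) refl

  step-suc : ∀ n τ y → step (suc n) τ y ≡ step n τ y + (τ * cosTerm y n - sinTerm y n)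
  step-suc n τ y = solve 6 (λ τ y S C s c →
    y :- ((S :+ s) :- τ :* (C :+ c)) := (y :- (S :- τ :* C)) :+ (τ :* c :- s)) refl
    τ y (sinSum n y) (cosSum n y) (sinTerm y n) (cosTerm y n)

  module _ {τ} (τ≤ : ∣ τ ∣ ≤ half 4) where

    step-increment : ∀ {y} → ∣ y ∣ ≤ half 3 → ∀ n →
      ∣ τ * cosTerm y (suc n) - sinTerm y (suc n) ∣ ≤ half (5 ℕ.+ n)
    step-increment {y} y≤ n = begin
      ∣ τ * cosTerm y (suc n) - sinTerm y (suc n) ∣
        ≤⟨ ∣-∣≤ (∣*∣≤ {τ} {half 4} {cosTerm y (suc n)} τ≤ (∣cosTerm∣≤ {y} y≤ (suc n)))
          (∣sinTerm∣≤ {y} y≤ (suc n)) ⟩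
      half 4 * half (2 ℕ.* suc n ℕ.* 3) + half (suc (2 ℕ.* suc n) ℕ.* 3)
        ≡⟨ cong (_+ half (suc (2 ℕ.* suc n) ℕ.* 3)) (sym (half-+ 4 (2 ℕ.* suc n ℕ.* 3))) ⟩
      half (4 ℕ.+ 2 ℕ.* suc n ℕ.* 3) + half (suc (2 ℕ.* suc n) ℕ.* 3)
        ≤⟨ ℚₚ.+-mono-≤ (half-antimono (ℕₚ.≤-trans (6+n≤ n) (ℕₚ.m≤n+m _ 4)))
          (half-antimono (ℕₚ.≤-trans (6+n≤ n) (ℕₚ.m≤n+m _ 3))) ⟩
      half (6 ℕ.+ n) + half (6 ℕ.+ n)
        ≡⟨ half-split (5 ℕ.+ n) ⟨
      half (5 ℕ.+ n) ∎
      where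
      open ℚₚ.≤-Reasoning
      6+n≤ : ∀ n → 6 ℕ.+ n ℕ.≤ 2 ℕ.* suc n ℕ.* 3
      6+n≤ n = ℕₚ.≤-trans (ℕₚ.+-monoʳ-≤ 6 (ℕₚ.m≤m*n n 6)) (ℕₚ.≤-reflexive (lemma n))
        where
        lemma : ∀ n → 6 ℕ.+ n ℕ.* 6 ≡ 2 ℕ.* suc n ℕ.* 3
        lemma = solve-∀ᴺ

    -- The slope takes up at most 1/16 of the allowed 1/8, and all further Taylor terms together at
    -- most another 1/16; `half (4 + n)` is the part not yet spent.
    ∣step∣≤ : ∀ {y} → ∣ y ∣ ≤ half 3 → ∀ n → ∣ step (suc n) τ y ∣ + half (4 ℕ.+ n) ≤ half 3
    ∣step∣≤ {y} y≤ zero = begin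
      ∣ step 1 τ y ∣ + half 4  ≡⟨ cong (λ p → ∣ p ∣ + half 4) (step-1 τ y) ⟩
      ∣ τ ∣ + half 4           ≤⟨ ℚₚ.+-monoˡ-≤ (half 4) τ≤ ⟩
      half 4 + half 4          ≡⟨ half-split 3 ⟨
      half 3                   ∎
      where open ℚₚ.≤-Reasoning
    ∣step∣≤ {y} y≤ (suc n) = begin
      ∣ step (suc (suc n)) τ y ∣ + half (5 ℕ.+ n)
        ≡⟨ cong (λ p → ∣ p ∣ + half (5 ℕ.+ n)) (step-suc (suc n) τ y) ⟩
      ∣ step (suc n) τ y + (τ * cosTerm y (suc n) - sinTerm y (suc n)) ∣ + half (5 ℕ.+ n)
        ≤⟨ ℚₚ.+-monoˡ-≤ (half (5 ℕ.+ n)) (∣+∣≤ {step (suc n) τ y} ℚₚ.≤-refl (step-increment {y} y≤ n)) ⟩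
      (∣ step (suc n) τ y ∣ + half (5 ℕ.+ n)) + half (5 ℕ.+ n)
        ≡⟨ trans (ℚₚ.+-assoc ∣ step (suc n) τ y ∣ (half (5 ℕ.+ n)) (half (5 ℕ.+ n)))
          (cong (λ h → ∣ step (suc n) τ y ∣ + h) (sym (half-split (4 ℕ.+ n)))) ⟩
      ∣ step (suc n) τ y ∣ + half (4 ℕ.+ n)
        ≤⟨ ∣step∣≤ {y} y≤ n ⟩
      half 3 ∎
      where open ℚₚ.≤-Reasoning

    -- The margin is what the higher Taylor terms can still add to the Lipschitz constant.
    step-contracts-with-margin : ∀ {y z} → ∣ y ∣ ≤ half 3 → ∣ z ∣ ≤ half 3 → ∀ n →
      ∣ step (suc n) τ y - step (suc n) τ z ∣ + half (2 ℕ.+ n) * ∣ y - z ∣ ≤ half 2 * ∣ y - z ∣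
    step-contracts-with-margin {y} {z} y≤ z≤ zero = ℚₚ.≤-reflexive (begin
      ∣ step 1 τ y - step 1 τ z ∣ + half 2 * e
        ≡⟨ cong (λ d → ∣ d ∣ + half 2 * e) (trans (cong₂ _-_ (step-1 τ y) (step-1 τ z))
          (ℚₚ.+-inverseʳ τ)) ⟩
      0ℚ + half 2 * e  ≡⟨ ℚₚ.+-identityˡ (half 2 * e) ⟩
      half 2 * e       ∎)
      where
      open ≡-Reasoning
      e = ∣ y - z ∣
    step-contracts-with-margin {y} {z} y≤ z≤ (suc n) = begin
      ∣ step (suc (suc n)) τ y - step (suc (suc n)) τ z ∣ + half (3 ℕ.+ n) * e
        ≡⟨ cong (λ d → ∣ d ∣ + half (3 ℕ.+ n) * e)
          (trans (cong₂ _-_ (step-suc (suc n) τ y) (step-suc (suc n) τ z))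
            (solve 7 (λ g h τ c s d t → (g :+ (τ :* c :- s)) :- (h :+ (τ :* d :- t)) :=
              (g :- h) :+ (τ :* (c :- d) :- (s :- t))) refl
              g h τ (cosTerm y (suc n)) (sinTerm y (suc n)) (cosTerm z (suc n)) (sinTerm z (suc n)))) ⟩
      ∣ (g - h) + (τ * (cosTerm y (suc n) - cosTerm z (suc n)) - (sinTerm y (suc n) - sinTerm z
        (suc n))) ∣ + half (3 ℕ.+ n) * e
        ≤⟨ ℚₚ.+-monoˡ-≤ (half (3 ℕ.+ n) * e) (∣+∣≤ {g - h} ℚₚ.≤-refl increment) ⟩
      (∣ g - h ∣ + (half (4 ℕ.+ n) * e + half (4 ℕ.+ n) * e)) + half (3 ℕ.+ n) * e
        ≡⟨ solve 3 (λ d k e → (d :+ (con ½ :* (con ½ :* k) :* e :+ con ½ :* (con ½ :* k) :* e)) :+ con ½ :* k :* e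
          := d :+ k :* e) refl ∣ g - h ∣ (half (2 ℕ.+ n)) e ⟩
      ∣ g - h ∣ + half (2 ℕ.+ n) * e
        ≤⟨ step-contracts-with-margin {y} {z} y≤ z≤ n ⟩
      half 2 * e ∎
      where
      open ℚₚ.≤-Reasoning
      e = ∣ y - z ∣
      g = step (suc n) τ y
      h = step (suc n) τ z
      *e-mono : ∀ {p q} → p ≤ q → p * e ≤ q * e
      *e-mono = ℚₚ.*-monoʳ-≤-nonNeg e {{ℚ.nonNegative (ℚₚ.0≤∣p∣ (y - z))}}
      cos≤ : ∣ τ * (cosTerm y (suc n) - cosTerm z (suc n)) ∣ ≤ half (4 ℕ.+ n) * e
      cos≤ = begin
        ∣ τ * (cosTerm y (suc n) - cosTerm z (suc n)) ∣
          ≤⟨ ∣*∣≤ {τ} {half 4} {cosTerm y (suc n) - cosTerm z (suc n)} τ≤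
            (∣cosTerm-∣≤ {y} {z} y≤ z≤ n) ⟩
        half 4 * (half ((n ℕ.+ 1 ℕ.* suc n) ℕ.* 2) * e)
          ≡⟨ ℚₚ.*-assoc (half 4) (half ((n ℕ.+ 1 ℕ.* suc n) ℕ.* 2)) e ⟨
        half 4 * half ((n ℕ.+ 1 ℕ.* suc n) ℕ.* 2) * e
          ≡⟨ cong (_* e) (half-+ 4 ((n ℕ.+ 1 ℕ.* suc n) ℕ.* 2)) ⟨
        half (4 ℕ.+ (n ℕ.+ 1 ℕ.* suc n) ℕ.* 2) * e
          ≤⟨ *e-mono (half-antimono (ℕₚ.+-monoʳ-≤ 4
            (ℕₚ.≤-trans (ℕₚ.m≤m+n n _) (ℕₚ.m≤m*n (n ℕ.+ 1 ℕ.* suc n) 2)))) ⟩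
        half (4 ℕ.+ n) * e                                    ∎
      sin≤ : ∣ sinTerm y (suc n) - sinTerm z (suc n) ∣ ≤ half (4 ℕ.+ n) * e
      sin≤ = ℚₚ.≤-trans (∣sinTerm-∣≤ {y} {z} y≤ z≤ (suc n)) (*e-mono (half-antimono (4+n≤ n)))
        where
        4+n≤ : ∀ n → 4 ℕ.+ n ℕ.≤ 2 ℕ.* suc n ℕ.* 2
        4+n≤ n = ℕₚ.≤-trans (ℕₚ.+-monoʳ-≤ 4 (ℕₚ.m≤m*n n 4)) (ℕₚ.≤-reflexive (lemma n))
          where
          lemma : ∀ n → 4 ℕ.+ n ℕ.* 4 ≡ 2 ℕ.* suc n ℕ.* 2
          lemma = solve-∀ᴺ
      increment : ∣ τ * (cosTerm y (suc n) - cosTerm z (suc n)) - (sinTerm y (suc n) - sinTerm z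
        (suc n)) ∣ ≤ half (4 ℕ.+ n) * e + half (4 ℕ.+ n) * e
      increment = ∣-∣≤ cos≤ sin≤

    step-contracts : ∀ {y z} → ∣ y ∣ ≤ half 3 → ∣ z ∣ ≤ half 3 → ∀ n →
      ∣ step (suc n) τ y - step (suc n) τ z ∣ ≤ half 2 * ∣ y - z ∣
    step-contracts {y} {z} y≤ z≤ n = ≤-by-difference
      (ℚₚ.+-mono-≤ (step-contracts-with-margin {y} {z} y≤ z≤ n)
        (0≤* (0≤half (2 ℕ.+ n)) (ℚₚ.0≤∣p∣ (y - z))))
      (solve 3 (λ d m r → r :- d := (r :+ m) :- (d :+ m :+ con 0ℚ))
        refl ∣ step (suc n) τ y - step (suc n) τ z ∣ (half (2 ℕ.+ n) * ∣ y - z ∣) (half 2 * ∣ y - z ∣))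

  step-τ : ∀ {y} → ∣ y ∣ ≤ half 3 → ∀ n τ τ′ → ∣ step n τ y - step n τ′ y ∣ ≤ ∣ τ - τ′ ∣ * (1ℚ + 1ℚ)
  step-τ {y} y≤ n τ τ′ = begin
    ∣ step n τ y - step n τ′ y ∣
      ≡⟨ cong ∣_∣ (solve 5 (λ y S C τ τ′ →
        (y :- (S :- τ :* C)) :- (y :- (S :- τ′ :* C)) := (τ :- τ′) :* C)
          refl y (sinSum n y) (cosSum n y) τ τ′) ⟩
    ∣ (τ - τ′) * cosSum n y ∣  ≤⟨ ∣*∣≤ {τ - τ′} {r = cosSum n y} ℚₚ.≤-refl cos≤2 ⟩
    ∣ τ - τ′ ∣ * (1ℚ + 1ℚ)     ∎
    where
    open ℚₚ.≤-Reasoning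
    cos≤2 : ∣ cosSum n y ∣ ≤ 1ℚ + 1ℚ
    cos≤2 = ≤-by-difference (ℚₚ.+-mono-≤ (∣cosSum∣≤2 {y} y≤ n) (ℚₚ.+-mono-≤ (0≤half n) (0≤half n)))
      (solve 2 (λ c h → (con (1ℚ + 1ℚ)) :- c :=
        ((con (1ℚ + 1ℚ)) :+ (h :+ h)) :- ((c :+ (h :+ h)) :+ (con 0ℚ :+ con 0ℚ)))
          refl ∣ cosSum n y ∣ (half n))

  -- Arctangents

  -- Approximations to a tangent. The bound keeps the iterates within 1/8 of zero, and the slowness
  -- keeps a changing slope from spoiling convergence.
  record SlopeSequence : Set where
    field
      slope   : ℕ → ℚ
      bounded : ∀ n → ∣ slope n ∣ ≤ half 4
      slow    : ∀ n → ∣ slope (suc n) - slope n ∣ ≤ half (5 ℕ.+ n)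

  open SlopeSequence

  -- Slope and Taylor order advance together with the iteration. The residual of the `n`-th
  -- truncated equation at the `n`-th iterate is therefore, up to sign, the difference of
  -- consecutive iterates.
  iterate : (ℕ → ℚ) → ℕ → ℚ
  iterate σ zero    = 0ℚ
  iterate σ (suc n) = step n (σ n) (iterate σ n)

  -- With empty sums `step 0` is the identity and does not contract, so the inductions below need
  -- two base cases.
  iterate-1 : ∀ σ → iterate σ 1 ≡ 0ℚ
  iterate-1 σ = solve 1 (λ t → con 0ℚ :- (con 0ℚ :- t :* con 0ℚ) := con 0ℚ) refl (σ 0)

  module _ (σ : SlopeSequence) where
    private
      ρ = iterate (slope σ)

    ∣iterate∣≤ : ∀ n → ∣ ρ n ∣ ≤ half 3
    ∣iterate∣≤ zero          = 0≤half 3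
    ∣iterate∣≤ (suc zero)    = subst (λ p → ∣ p ∣ ≤ half 3) (sym (iterate-1 (slope σ))) (0≤half 3)
    ∣iterate∣≤ (suc (suc n)) = ≤-by-difference
      (ℚₚ.+-mono-≤ (∣step∣≤ (bounded σ (suc n)) {ρ (suc n)} (∣iterate∣≤ (suc n)) n) (0≤half (4 ℕ.+ n)))
      (solve 3 (λ d m r → r :- d := (r :+ m) :- (d :+ m :+ con 0ℚ))
        refl ∣ ρ (suc (suc n)) ∣ (half (4 ℕ.+ n)) (half 3))

    -- Three changes add up: the slope, the next Taylor terms, and the contracted previous
    -- difference. With `k = half (2 + n)` they contribute at most `k/8`, `k/8` and `k/4`, in total
    -- `k/2`.
    iterate-slow : ∀ n → ∣ ρ (suc n) - ρ n ∣ ≤ half (suc n)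
    iterate-slow zero          = subst (λ p → ∣ p - 0ℚ ∣ ≤ half 1) (sym (iterate-1 (slope σ)))
      (0≤half 1)
    iterate-slow (suc zero)    = subst (λ p → ∣ ρ 2 - p ∣ ≤ half 2) (sym (iterate-1 (slope σ)))
      (subst (λ p → ∣ p ∣ ≤ half 2) (sym (solve 1 (λ p → p :- con 0ℚ := p) refl (ρ 2)))
        (ℚₚ.≤-trans (∣iterate∣≤ 2) (half-antimono (ℕₚ.n≤1+n 2))))
    iterate-slow (suc (suc n)) = begin
      ∣ step (2 ℕ.+ n) τ′ y - step (1 ℕ.+ n) τ z ∣
        ≡⟨ cong ∣_∣ (trans
             (solve 4 (λ a b c d → a :- d := (a :- b) :+ ((b :- c) :+ (c :- d)))
               refl (step (2 ℕ.+ n) τ′ y) (step (2 ℕ.+ n) τ y) (step (1 ℕ.+ n) τ y)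
                 (step (1 ℕ.+ n) τ z))
             (cong (λ d → (step (2 ℕ.+ n) τ′ y - step
               (2 ℕ.+ n) τ y) + (d + (step (1 ℕ.+ n) τ y - step (1 ℕ.+ n) τ z)))
               (trans (cong (_- step (1 ℕ.+ n) τ y) (step-suc (suc n) τ y))
                      (solve 2 (λ g d → (g :+ d) :- g := d)
                        refl (step (1 ℕ.+ n) τ y) (τ * cosTerm y (suc n) - sinTerm y (suc n)))))) ⟩
      ∣ (step (2 ℕ.+ n) τ′ y - step (2 ℕ.+ n) τ y) + ((τ * cosTerm y (suc n) - sinTerm y
        (suc n)) + (step (1 ℕ.+ n) τ y - step (1 ℕ.+ n) τ z)) ∣
        ≤⟨ ∣+∣≤ {step (2 ℕ.+ n) τ′ y - step (2 ℕ.+ n) τ y}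
             (ℚₚ.≤-trans (step-τ {y} (∣iterate∣≤ (2 ℕ.+ n)) (2 ℕ.+ n) τ′ τ)
               (ℚₚ.*-monoʳ-≤-nonNeg (1ℚ + 1ℚ) (slow σ (suc n))))
             (∣+∣≤ {τ * cosTerm y (suc n) - sinTerm y (suc n)}
               (step-increment (bounded σ (suc n)) {y} (∣iterate∣≤ (2 ℕ.+ n)) n)
               (ℚₚ.≤-trans (step-contracts (bounded σ (suc n)) {y} {z} (∣iterate∣≤ (2 ℕ.+ n))
                 (∣iterate∣≤ (1 ℕ.+ n)) n)
                 (ℚₚ.*-monoˡ-≤-nonNeg (half 2) (iterate-slow (suc n))))) ⟩
      half (6 ℕ.+ n) * (1ℚ + 1ℚ) + (half (5 ℕ.+ n) + half 2 * half (2 ℕ.+ n))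
        ≡⟨ solve 1 (λ k → let ½:* = λ p → con ½ :* p in
             ½:* (½:* (½:* (½:* k))) :* con (1ℚ + 1ℚ) :+ (½:* (½:* (½:* k)) :+ con (half 2) :* k)
               := ½:* k) refl (half (2 ℕ.+ n)) ⟩
      half (3 ℕ.+ n) ∎
      where
      open ℚₚ.≤-Reasoning
      τ′ = slope σ (2 ℕ.+ n)
      τ = slope σ (1 ℕ.+ n)
      y = ρ (2 ℕ.+ n)
      z = ρ (1 ℕ.+ n)

    arctan : ℝ
    arctan = record
      { approx = ρ
      ; cauchy = telescope⇒cauchy ρ λ n → subst (∣ ρ (suc n) - ρ n ∣ ≤_)
        (sym (ℚₚ.*-identityˡ (half (suc n)))) (iterate-slow n)
      }

    -- Once the slope equals `b / a`, the defect in `HasDirection` is `- a` times the difference of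
    -- consecutive iterates. The reciprocal `u` of `a` converts `ε` into the required bound on that
    -- difference.
    arctan-hasDirection : ∀ {a b u} → 0ℚ < u → fromℤ a * u ≡ 1ℚ →
      ∀ {j} → (∀ n → j ℕ.≤ n → fromℤ a * slope σ n ≡ fromℤ b) → HasDirection (a , b) arctan
    arctan-hasDirection {a} {b} {u} 0<u au≡1 {j} eventually ε 0<ε with archimedean (0<* 0<ε 0<u)
    ... | M , halfM<εu = j ℕ.⊔ M , λ n j⊔M≤n → begin-strict
      ∣ fromℤ a * sinSum n (ρ n) - fromℤ b * cosSum n (ρ n) ∣
        ≡⟨ cong (λ p → ∣ fromℤ a * sinSum n (ρ n) - p * cosSum n (ρ n) ∣)
          (eventually n (ℕₚ.m⊔n≤o⇒m≤o j M j⊔M≤n)) ⟨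
      ∣ fromℤ a * sinSum n (ρ n) - fromℤ a * slope σ n * cosSum n (ρ n) ∣
        ≡⟨ cong ∣_∣ (solve 5 (λ a s t c y → a :* s :- a :* t :* c :=
          (:- a) :* ((y :- (s :- t :* c)) :- y))
            refl (fromℤ a) (sinSum n (ρ n)) (slope σ n) (cosSum n (ρ n)) (ρ n)) ⟩
      ∣ (- fromℤ a) * (ρ (suc n) - ρ n) ∣
        ≤⟨ ∣*∣≤ { - fromℤ a} {fromℤ a} {ρ (suc n) - ρ n}
          (ℚₚ.≤-reflexive (trans (ℚₚ.∣-p∣≡∣p∣ (fromℤ a)) (ℚₚ.0≤p⇒∣p∣≡p 0≤a))) (iterate-slow n) ⟩
      fromℤ a * half (suc n)
        ≤⟨ ℚₚ.*-monoˡ-≤-nonNeg (fromℤ a) {{ℚ.nonNegative 0≤a}}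
          (half-antimono (ℕₚ.≤-trans (ℕₚ.m⊔n≤o⇒n≤o j M j⊔M≤n) (ℕₚ.n≤1+n n))) ⟩
      fromℤ a * half M
        <⟨ ℚₚ.*-monoʳ-<-pos (fromℤ a) {{ℚ.positive 0<a}} halfM<εu ⟩
      fromℤ a * (ε * u)
        ≡⟨ solve 3 (λ a e u → a :* (e :* u) := e :* (a :* u)) refl (fromℤ a) ε u ⟩
      ε * (fromℤ a * u)
        ≡⟨ trans (cong (ε *_) au≡1) (ℚₚ.*-identityʳ ε) ⟩
      ε ∎
      where
      open ℚₚ.≤-Reasoning
      0<a : 0ℚ < fromℤ a
      0<a = ℚₚ.*-cancelʳ-<-nonNeg u {{ℚ.nonNegative (ℚₚ.<⇒≤ 0<u)}}
        (subst₂ _<_ (sym (ℚₚ.*-zeroˡ u)) (sym au≡1) (ℚ.*<* (ℤ.+<+ (ℕ.s≤s ℕ.z≤n))))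
      0≤a : 0ℚ ≤ fromℤ a
      0≤a = ℚₚ.<⇒≤ 0<a

  -- Continuity of the arctangent: a slope error of `δ/4` costs at most `δ/2`, and the contraction
  -- passes on `δ/4` of the previous error, which stays below `δ`.
  ∣iterate-∣≤ : ∀ σ σ′ δ → (∀ n → ∣ slope σ n - slope σ′ n ∣ ≤ half 2 * δ) →
                ∀ n → ∣ iterate (slope σ) n - iterate (slope σ′) n ∣ ≤ δ
  ∣iterate-∣≤ σ σ′ δ close = go
    where
    0≤δ : 0ℚ ≤ δ
    0≤δ = ℚₚ.*-cancelˡ-≤-pos (half 2) (ℚₚ.≤-trans (ℚₚ.0≤∣p∣ (slope σ 0 - slope σ′ 0)) (close 0))
    go : ∀ n → ∣ iterate (slope σ) n - iterate (slope σ′) n ∣ ≤ δ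
    go zero       = 0≤δ
    go (suc zero) = subst₂ (λ p q → ∣ p - q ∣ ≤ δ) (sym (iterate-1 (slope σ)))
      (sym (iterate-1 (slope σ′))) 0≤δ
    go (suc (suc n)) = begin
      ∣ step (suc n) τ y - step (suc n) τ′ z ∣
        ≡⟨ cong ∣_∣ (solve 3 (λ a b c → a :- c := (a :- b) :+ (b :- c))
          refl (step (suc n) τ y) (step (suc n) τ′ y) (step (suc n) τ′ z)) ⟩
      ∣ (step (suc n) τ y - step (suc n) τ′ y) + (step (suc n) τ′ y - step (suc n) τ′ z) ∣
        ≤⟨ ∣+∣≤ {step (suc n) τ y - step (suc n) τ′ y}
            (ℚₚ.≤-trans (step-τ {y} (∣iterate∣≤ σ (suc n)) (suc n) τ τ′)
              (ℚₚ.*-monoʳ-≤-nonNeg (1ℚ + 1ℚ) (close (suc n))))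
            (ℚₚ.≤-trans (step-contracts (bounded σ′ (suc n)) {y} {z} (∣iterate∣≤ σ (suc n))
              (∣iterate∣≤ σ′ (suc n)) n) (ℚₚ.*-monoˡ-≤-nonNeg (half 2) (go (suc n)))) ⟩
      half 2 * δ * (1ℚ + 1ℚ) + half 2 * δ
        ≤⟨ ≤-by-difference (0≤* (0≤half 2) 0≤δ)
          (solve 1 (λ d → d :- (con (half 2) :* d :* con (1ℚ + 1ℚ) :+ con (half 2) :* d) := con
            (half 2) :* d :- con 0ℚ) refl δ) ⟩
      δ ∎
      where
      open ℚₚ.≤-Reasoning
      τ = slope σ (suc n)
      τ′ = slope σ′ (suc n)
      y = iterate (slope σ) (suc n)
      z = iterate (slope σ′) (suc n)

  -- The directions of the points kernelPoint j

  fromℤ-+ : ∀ m n → fromℤ (m ℤ.+ n) ≡ fromℤ m + fromℤ n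
  fromℤ-+ m n = ℚₚ.toℚᵘ-injective (begin
    ℚ.toℚᵘ (fromℤ (m ℤ.+ n))  ≈⟨ ℚₚ.toℚᵘ-fromℚᵘ (mkℚᵘ (m ℤ.+ n) 0) ⟩
    mkℚᵘ (m ℤ.+ n) 0
      ≈⟨ ℚᵘ.*≡* (cong (ℤ._* 1ℤ) (sym (cong₂ ℤ._+_ (ℤₚ.*-identityʳ m) (ℤₚ.*-identityʳ n)))) ⟩
    mkℚᵘ m 0 ℚᵘ.+ mkℚᵘ n 0
      ≈⟨ ℚᵘₚ.+-cong (ℚₚ.toℚᵘ-fromℚᵘ (mkℚᵘ m 0)) (ℚₚ.toℚᵘ-fromℚᵘ (mkℚᵘ n 0)) ⟨
    ℚ.toℚᵘ (fromℤ m) ℚᵘ.+ ℚ.toℚᵘ (fromℤ n)  ≈⟨ ℚₚ.toℚᵘ-homo-+ (fromℤ m) (fromℤ n) ⟨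
    ℚ.toℚᵘ (fromℤ m + fromℤ n)              ∎)
    where open import Relation.Binary.Reasoning.Setoid ℚᵘₚ.≃-setoid

  fromℤ-* : ∀ m n → fromℤ (m ℤ.* n) ≡ fromℤ m * fromℤ n
  fromℤ-* m n = ℚₚ.toℚᵘ-injective (begin
    ℚ.toℚᵘ (fromℤ (m ℤ.* n))  ≈⟨ ℚₚ.toℚᵘ-fromℚᵘ (mkℚᵘ (m ℤ.* n) 0) ⟩
    mkℚᵘ m 0 ℚᵘ.* mkℚᵘ n 0
      ≈⟨ ℚᵘₚ.*-cong (ℚₚ.toℚᵘ-fromℚᵘ (mkℚᵘ m 0)) (ℚₚ.toℚᵘ-fromℚᵘ (mkℚᵘ n 0)) ⟨
    ℚ.toℚᵘ (fromℤ m) ℚᵘ.* ℚ.toℚᵘ (fromℤ n)  ≈⟨ ℚₚ.toℚᵘ-homo-* (fromℤ m) (fromℤ n) ⟨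
    ℚ.toℚᵘ (fromℤ m * fromℤ n)              ∎)
    where open import Relation.Binary.Reasoning.Setoid ℚᵘₚ.≃-setoid

  fromℤ-scale : ∀ j → fromℤ (+ scale j) ≡ fromℤ (+ 2) * fromℤ (+ den j)
  fromℤ-scale j = trans (cong fromℤ (ℤₚ.pos-* 2 (den j))) (fromℤ-* (+ 2) (+ den j))

  fromℤ-den : ∀ j → fromℤ (+ den (suc j)) ≡ fromℤ (+ 2) * fromℤ (+ den j) * fromℤ (+ den j)
  fromℤ-den j = trans (cong fromℤ (ℤₚ.pos-* (scale j) (den j)))
    (trans (fromℤ-* (+ scale j) (+ den j)) (cong (_* fromℤ (+ den j)) (fromℤ-scale j)))

  fromℤ-num : ∀ j → fromℤ (+ num (suc j)) ≡ 1ℚ + fromℤ (+ 2) * fromℤ (+ den j) * fromℤ (+ num j)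
  fromℤ-num j = trans (fromℤ-+ 1ℤ (+ (scale j ℕ.* num j))) (cong (λ p → 1ℚ + p)
    (trans (cong fromℤ (ℤₚ.pos-* (scale j) (num j)))
      (trans (fromℤ-* (+ scale j) (+ num j)) (cong (_* fromℤ (+ num j)) (fromℤ-scale j)))))

  -- Reciprocals without division, following `den (suc j) = 2 * den j * den j`.
  1/den : ℕ → ℚ
  1/den zero    = half 4
  1/den (suc j) = ½ * (1/den j * 1/den j)

  den*1/den≡1 : ∀ j → fromℤ (+ den j) * 1/den j ≡ 1ℚ
  den*1/den≡1 zero    = refl
  den*1/den≡1 (suc j) = begin
    fromℤ (+ den (suc j)) * (½ * (u * u))  ≡⟨ cong (_* (½ * (u * u))) (fromℤ-den j) ⟩
    fromℤ (+ 2) * a * a * (½ * (u * u))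
      ≡⟨ solve 2 (λ a u → con (fromℤ (+ 2)) :* a :* a :* (con ½ :* (u :* u)) := (a :* u) :* (a :* u))
        refl a u ⟩
    (a * u) * (a * u)  ≡⟨ cong₂ _*_ (den*1/den≡1 j) (den*1/den≡1 j) ⟩
    1ℚ                 ∎
    where
    open ≡-Reasoning
    a = fromℤ (+ den j)
    u = 1/den j

  0<1/den : ∀ j → 0ℚ < 1/den j
  0<1/den zero    = ℚ.*<* (ℤ.+<+ (ℕ.s≤s ℕ.z≤n))
  0<1/den (suc j) = 0<* {½} (ℚ.*<* (ℤ.+<+ (ℕ.s≤s ℕ.z≤n))) (0<* (0<1/den j) (0<1/den j))

  1/den≤half : ∀ j → 1/den j ≤ half (4 ℕ.+ j)
  1/den≤half zero    = ℚₚ.≤-refl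
  1/den≤half (suc j) = ℚₚ.*-monoˡ-≤-nonNeg ½ (begin
    1/den j * 1/den j
      ≤⟨ ℚₚ.*-monoʳ-≤-nonNeg (1/den j) {{ℚ.nonNegative (ℚₚ.<⇒≤ (0<1/den j))}}
        (ℚₚ.≤-trans (1/den≤half j) (half≤1 (4 ℕ.+ j))) ⟩
    1ℚ * 1/den j    ≡⟨ ℚₚ.*-identityˡ (1/den j) ⟩
    1/den j         ≤⟨ 1/den≤half j ⟩
    half (4 ℕ.+ j)  ∎)
    where open ℚₚ.≤-Reasoning

  -- The partial sums of the series for α.
  num/den : ℕ → ℚ
  num/den zero    = 0ℚ
  num/den (suc j) = num/den j + 1/den (suc j)

  den*num/den≡num : ∀ j → fromℤ (+ den j) * num/den j ≡ fromℤ (+ num j)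
  den*num/den≡num zero    = refl
  den*num/den≡num (suc j) = begin
    fromℤ (+ den (suc j)) * (num/den j + 1/den (suc j))
      ≡⟨ ℚₚ.*-distribˡ-+ (fromℤ (+ den (suc j))) (num/den j) (1/den (suc j)) ⟩
    fromℤ (+ den (suc j)) * num/den j + fromℤ (+ den (suc j)) * 1/den (suc j)
      ≡⟨ cong₂ (λ p q → p * num/den j + q) (fromℤ-den j) (den*1/den≡1 (suc j)) ⟩
    fromℤ (+ 2) * a * a * num/den j + 1ℚ
      ≡⟨ solve 3 (λ two a t → two :* a :* a :* t :+ con 1ℚ := con 1ℚ :+ two :* a :* (a :* t))
        refl (fromℤ (+ 2)) a (num/den j) ⟩
    1ℚ + fromℤ (+ 2) * a * (a * num/den j)
      ≡⟨ cong (λ b → 1ℚ + fromℤ (+ 2) * a * b) (den*num/den≡num j) ⟩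
    1ℚ + fromℤ (+ 2) * a * fromℤ (+ num j)  ≡⟨ fromℤ-num j ⟨
    fromℤ (+ num (suc j))                   ∎
    where
    open ≡-Reasoning
    a = fromℤ (+ den j)

  num/den-slow : ∀ n → ∣ num/den (suc n) - num/den n ∣ ≤ half (5 ℕ.+ n)
  num/den-slow n = subst (_≤ half (5 ℕ.+ n))
    (sym (trans (cong ∣_∣ (solve 2 (λ t u → (t :+ u) :- t := u) refl (num/den n) (1/den (suc n))))
      (ℚₚ.0≤p⇒∣p∣≡p (ℚₚ.<⇒≤ (0<1/den (suc n))))))
    (1/den≤half (suc n))

  num/den-close : ∀ {M n} → M ℕ.≤ n → ∣ num/den n - num/den M ∣ ≤ half 4 * half M
  num/den-close = telescope≤ num/den (half 4) (0≤half 4) λ n →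
    subst (∣ num/den (suc n) - num/den n ∣ ≤_) (half-+ 4 (suc n)) (num/den-slow n)

  num/den-bounded : ∀ n → ∣ num/den n ∣ ≤ half 4
  num/den-bounded n = subst₂ _≤_ (cong ∣_∣ (solve 1 (λ t → t :- con 0ℚ := t) refl (num/den n)))
    (ℚₚ.*-identityʳ (half 4)) (num/den-close {0} {n} ℕ.z≤n)

  limitSlope : SlopeSequence
  limitSlope = record { slope = num/den ; bounded = num/den-bounded ; slow = num/den-slow }

  -- Freezing the slope only from j on makes the iterates agree with those of limitSlope up to j.
  stageSlope : ℕ → SlopeSequence
  stageSlope j = record
    { slope   = λ n → num/den (n ℕ.⊓ j)
    ; bounded = λ n → num/den-bounded (n ℕ.⊓ j)
    ; slow    = frozen-slow
    }
    where
    frozen-slow : ∀ n → ∣ num/den (suc n ℕ.⊓ j) - num/den (n ℕ.⊓ j) ∣ ≤ half (5 ℕ.+ n)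
    frozen-slow n with ℕₚ.≤-<-connex j n
    ... | inj₁ j≤n rewrite ℕₚ.m≥n⇒m⊓n≡n j≤n | ℕₚ.m≥n⇒m⊓n≡n (ℕₚ.m≤n⇒m≤1+n j≤n) | ℚₚ.+-inverseʳ
      (num/den j) = 0≤half (5 ℕ.+ n)
    ... | inj₂ n<j rewrite ℕₚ.m≤n⇒m⊓n≡m n<j | ℕₚ.m≤n⇒m⊓n≡m (ℕₚ.<⇒≤ n<j) = num/den-slow n

  stageSlope-close : ∀ j n → ∣ slope (stageSlope j) n - slope limitSlope n ∣ ≤ half 4 * half j
  stageSlope-close j n with ℕₚ.≤-total j n
  ... | inj₁ j≤n rewrite ℕₚ.m≥n⇒m⊓n≡n j≤n =
    subst (_≤ half 4 * half j) (∣-∣-comm (num/den n) (num/den j)) (num/den-close j≤n)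
  ... | inj₂ n≤j rewrite ℕₚ.m≤n⇒m⊓n≡m n≤j | ℚₚ.+-inverseʳ (num/den n) = 0≤* (0≤half 4) (0≤half j)

  kernelPoint-hasDirection : ∀ j → HasDirection (kernelPoint j) (arctan (stageSlope j))
  kernelPoint-hasDirection j = arctan-hasDirection (stageSlope j) {+ den j} {+ num j} (0<1/den j)
    (den*1/den≡1 j) {j}
    λ n j≤n → trans (cong (λ i → fromℤ (+ den j) * num/den i) (ℕₚ.m≥n⇒m⊓n≡n j≤n)) (den*num/den≡num j)

  stage-limit-close : ∀ j n → ∣ iterate (slope (stageSlope j)) n - iterate
    (slope limitSlope) n ∣ ≤ half j
  stage-limit-close j = ∣iterate-∣≤ (stageSlope j) limitSlope (half j) λ n →
    ℚₚ.≤-trans (stageSlope-close j n)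
    (ℚₚ.*-monoʳ-≤-nonNeg (half j) {{ℚ.nonNegative (0≤half j)}}
      (half-antimono {2} {4} (ℕ.s≤s (ℕ.s≤s ℕ.z≤n))))

  recurrenceDirection : ∀ m → arctan limitSlope ∈ RecurrenceDirection (word m)
  recurrenceDirection m ε (δ , 0<δ , M , δ≤ε) N _ with archimedean
    (0<* {½} {δ} (ℚ.*<* (ℤ.+<+ (ℕ.s≤s ℕ.z≤n))) 0<δ)
  ... | K , halfK<½δ =
    kernelPoint j , q≢0² , word-recurrent m (ℕₚ.m≤n+m N K) , arctan
      (stageSlope j) , kernelPoint-hasDirection j ,
    -- The angles are close without a multiple of π. Half of `δ` bounds their distance, and the
    -- other half is the margin demanded by `≺`.
    0ℤ , ½ * δ , 0<* {½} {δ} (ℚ.*<* (ℤ.+<+ (ℕ.s≤s ℕ.z≤n))) 0<δ , M , λ n M≤n → begin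
      ∣ φ n - θ n - fromℤ 0ℤ * π n ∣ + ½ * δ
        ≡⟨ cong (λ d → ∣ d ∣ + ½ * δ) (solve 3 (λ a b p → a :- b :- con 0ℚ :* p := a :- b)
          refl (φ n) (θ n) (π n)) ⟩
      ∣ φ n - θ n ∣ + ½ * δ
        ≤⟨ ℚₚ.+-monoˡ-≤ (½ * δ) (ℚₚ.≤-trans (stage-limit-close j n)
          (ℚₚ.≤-trans (half-antimono (ℕₚ.m≤n⇒m≤1+n (ℕₚ.m≤m+n K N))) (ℚₚ.<⇒≤ halfK<½δ))) ⟩
      ½ * δ + ½ * δ
        ≡⟨ solve 1 (λ d → con ½ :* d :+ con ½ :* d := con 0ℚ :+ d) refl δ ⟩
      0ℚ + δ      ≤⟨ δ≤ε n M≤n ⟩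
      approx ε n  ∎
    where
    open ℚₚ.≤-Reasoning
    -- `K` brings the angle within `½ * δ` of the limit, `N` makes the translation preserve the box,
    -- and `suc` matches `word-recurrent`.
    j = suc (K ℕ.+ N)
    φ θ : Sequence
    φ = approx (arctan (stageSlope j))
    θ = approx (arctan limitSlope)
    q≢0² : kernelPoint j ≢ 0²
    q≢0² eq = ℕₚ.<⇒≢ (ℕₚ.≤-<-trans ℕ.z≤n (j<den j)) (sym (ℤₚ.+-injective (cong proj₁ eq)))

  transverse : ∀ m → arctan limitSlope ∈ TransverseRecurrenceDirection (word m)
  transverse m = recurrenceDirection m , λ (B , proper , (p , p∈H , p≢0²) , _) →
    p≢0² (sym (proj₁ (H≐｛0²｝ m B proper) p∈H))

open import Data.Nat using (_≤_; _+_; _*_; _∸_)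

proposition1p8 : ∀ (r : ℕ) → 2 ≤ r → Σ (Word (Fin r)) λ x →
    (∀ B → Proper B → H B x ≐ ｛ 0² ｝)
    × (∃[ θ ] θ ∈ TransverseRecurrenceDirection x)
    × (∀ k → 1 ≤ k → (r ∸ 1) * k + 1 ∈ AbelianMaximalPatternComplexity x k)
    × NonDoublyPeriodicByProjection x
-- Counting `m = r - 1` shifted points yields exactly the letters from 0 to `m`.
proposition1p8 (suc m) _ =
  word m ,
  H≐｛0²｝ m ,
  (arctan limitSlope , transverse m) ,
  (λ k _ → subst (_∈ AbelianMaximalPatternComplexity (word m) k) (ℕₚ.+-comm 1 (m * k))
             (maximalPatternComplexity m k)) ,
  nonDoublyPeriodic m
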